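{- As formal power series in $x$ with coefficients in $\mathbb{Q}[s,t]$, $$P^{(\mathsf{pk},\mathsf{dbl})}(s,t;x)=\frac{\frac{\partial}{\partial x}V(s,t;x)}{1-sV(s,t;x)}.$$
   Context: Let $\mathfrak{S}_n$ be the set of permutations $\pi=\pi_1\cdots\pi_n$ (one-line notation) of $[n]=\{1,\dots,n\}$. Use the convention $\pi_0=\pi_{n+1}=\infty$. A letter $\pi_i$ ($1\le i\le n$) of $\pi$ is a peak if $\pi_{i-1}<\pi_i>\pi_{i+1}$ (so necessarily $2\le i\le n-1$), a double ascent if $\pi_{i-1}<\pi_i<\pi_{i+1}$, and a double descent if $\pi_{i-1}>\pi_i>\pi_{i+1}$. Let $\mathsf{pk}(\pi)$ be the number of peaks of $\pi$ and $\mathsf{dbl}(\pi)$ the total number of double ascents and double descents of $\pi$. Define $$P^{(\mathsf{pk},\mathsf{dbl})}(s,t;x)=\sum_{n=1}^\infty\Big(\sum_{\pi\in\mathfrak{S}_n}s^{\mathsf{pk}(\pi)}t^{\mathsf{dbl}(\pi)}\Big)\frac{x^n}{n!}.$$ The bivariate Chebyshev polynomials of the second kind are defined by $U_0(s,t)=1$, $U_1(s,t)=2t$, and $U_n(s,t)=2tU_{n-1}(s,t)-sU_{n-2}(s,t)$ for $n\ge2$. Define $V(s,t;x)=\sum_{n=0}^\infty U_n(s,t)\frac{x^{n+2}}{(n+2)!}$. -}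

module Defs where

open import Algebra.Bundles using (AbelianGroup; CommutativeRing)
import Algebra.Construct.Pointwise as Pointwise
open import Algebra.Morphism.Structures using (IsGroupMonomorphism)
import Algebra.Morphism.GroupMonomorphism as GroupMonomorphism
import Algebra.Properties.CommutativeSemigroup as CommutativeSemigroupProperties
import Algebra.Properties.Ring as RingProperties
import Algebra.Properties.Semiring.Exp as Exp
import Algebra.Properties.Semiring.Mult as Mult
import Algebra.Properties.Semiring.Sum as Sum
open import Algebra.Structures using (IsAbelianGroup; IsCommutativeRing)
open import Data.Fin.Base using (toℕ)
open import Data.Integer.Base using (+_)
open import Data.List.Base
  using (List; []; _∷_; _++_; _∷ʳ_; map; concatMap; foldr; filter; length; applyDownFrom)
open import Data.List.Membership.Propositional using (_∈_; _∉_; find; lose)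
open import Data.List.Membership.Propositional.Properties
  using (∈-map⁺; ∈-map⁻; ∈-concatMap⁺; ∈-concatMap⁻; ∈-∃++)
open import Data.List.Relation.Binary.Permutation.Propositional
  using (_↭_; ↭-refl; ↭-trans; ↭-sym; prep; swap)
open import Data.List.Relation.Binary.Permutation.Propositional.Properties
  using (∈-resp-↭; drop-mid; ↭-empty-inv)
open import Data.List.Relation.Unary.All as All using (All; []; _∷_)
open import Data.List.Relation.Unary.All.Properties as All using (All¬⇒¬Any)
open import Data.List.Relation.Unary.AllPairs using ([]; _∷_)
open import Data.List.Relation.Unary.Any using (here; there)
open import Data.List.Relation.Unary.Unique.Propositional using (Unique)
import Data.List.Relation.Unary.Unique.Propositional.Properties as Unique
open import Data.Nat.Base as ℕ using (ℕ; zero; suc; _!; _∸_)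
import Data.Nat.Properties as ℕ
open import Data.Product.Base using (_×_; _,_)
open import Data.Rational.Base as ℚ using (ℚ)
import Data.Rational.Properties as ℚ
open import Function.Base using (_∘_)
open import Function.Bundles using (_⇔_; mk⇔)
open import Level using (0ℓ)
open import Relation.Binary.Core using (Rel)
open import Relation.Binary.Construct.Add.Supremum.Strict (ℕ._<_)
  using (_<⁺_; <⁺-dec)
open import Relation.Binary.PropositionalEquality as ≡ using (_≡_)
import Relation.Binary.Reasoning.Setoid as SetoidReasoning
open import Relation.Nullary.Construct.Add.Supremum using (_⁺; ⊤⁺; [_])
open import Relation.Nullary.Decidable using (Dec; _×-dec_)
open import Relation.Nullary.Negation using (contradiction)
open import Relation.Unary using (Pred; Decidable)

-- A univariate polynomial is its list of coefficients, constant term first; trailing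
-- zeros are allowed, so equality compares coefficients.

module Polynomial {c ℓ} (R : CommutativeRing c ℓ) where

  open CommutativeRing R
  open RingProperties ring using (-0#≈0#)

  Poly : Set c
  Poly = List Carrier

  coeff : Poly → ℕ → Carrier
  coeff []      _       = 0#
  coeff (a ∷ p) zero    = a
  coeff (a ∷ p) (suc i) = coeff p i

  infix  4 _≈ₚ_
  infixl 6 _+ₚ_
  infixl 7 _*ₚ_ _·ₚ_

  record _≈ₚ_ (p q : Poly) : Set ℓ where
    constructor mk≈
    field coeff≈ : ∀ i → coeff p i ≈ coeff q i
  open _≈ₚ_ public

  _+ₚ_ : Poly → Poly → Poly
  []      +ₚ q       = q
  p       +ₚ []      = p
  (a ∷ p) +ₚ (b ∷ q) = a + b ∷ p +ₚ q

  -ₚ_ : Poly → Poly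
  -ₚ_ = map (-_)

  _·ₚ_ : Carrier → Poly → Poly
  a ·ₚ p = map (a *_) p

  _*ₚ_ : Poly → Poly → Poly
  []      *ₚ q = []
  (a ∷ p) *ₚ q = a ·ₚ q +ₚ (0# ∷ p *ₚ q)

  C : Carrier → Poly
  C a = a ∷ []

  X : Poly
  X = 0# ∷ 1# ∷ []

  coeff-+ : ∀ p q i → coeff (p +ₚ q) i ≈ coeff p i + coeff q i
  coeff-+ []      q       i       = sym (+-identityˡ _)
  coeff-+ (a ∷ p) []      i       = sym (+-identityʳ _)
  coeff-+ (a ∷ p) (b ∷ q) zero    = refl
  coeff-+ (a ∷ p) (b ∷ q) (suc i) = coeff-+ p q i

  coeff-neg : ∀ p i → coeff (-ₚ p) i ≈ - coeff p i
  coeff-neg []      i       = sym -0#≈0#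
  coeff-neg (a ∷ p) zero    = refl
  coeff-neg (a ∷ p) (suc i) = coeff-neg p i

  coeff-· : ∀ a p i → coeff (a ·ₚ p) i ≈ a * coeff p i
  coeff-· a []      i       = sym (zeroʳ a)
  coeff-· a (b ∷ p) zero    = refl
  coeff-· a (b ∷ p) (suc i) = coeff-· a p i

  private
    coefficients : AbelianGroup c ℓ
    coefficients = Pointwise.abelianGroup ℕ +-abelianGroup

    coeff-isGroupMonomorphism : IsGroupMonomorphism
      (record { _≈_ = _≈ₚ_ ; _∙_ = _+ₚ_ ; ε = [] ; _⁻¹ = -ₚ_ })
      (AbelianGroup.rawGroup coefficients)
      coeff
    coeff-isGroupMonomorphism = record
      { isGroupHomomorphism = record
        { isMonoidHomomorphism = record
          { isMagmaHomomorphism = record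
            { isRelHomomorphism = record { cong = coeff≈ }
            ; homo = coeff-+
            }
          ; ε-homo = λ _ → refl
          }
        ; ⁻¹-homo = coeff-neg
        }
      ; injective = mk≈
      }

  +ₚ-isAbelianGroup : IsAbelianGroup _≈ₚ_ _+ₚ_ [] -ₚ_
  +ₚ-isAbelianGroup = GroupMonomorphism.isAbelianGroup coeff-isGroupMonomorphism
    (AbelianGroup.isAbelianGroup coefficients)

  private
    module +ₚ = IsAbelianGroup +ₚ-isAbelianGroup
    module ≈ₚ-Reasoning = SetoidReasoning +ₚ.setoid

    +ₚ-abelianGroup : AbelianGroup c ℓ
    +ₚ-abelianGroup = record { isAbelianGroup = +ₚ-isAbelianGroup }

    open CommutativeSemigroupProperties (AbelianGroup.commutativeSemigroup +ₚ-abelianGroup)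
      using (interchange; x∙yz≈y∙xz)

    ∷-cong : ∀ {a b p q} → a ≈ b → p ≈ₚ q → a ∷ p ≈ₚ b ∷ q
    ∷-cong a≈b p≈q .coeff≈ zero    = a≈b
    ∷-cong a≈b p≈q .coeff≈ (suc i) = coeff≈ p≈q i

    ∷-injectiveʳ : ∀ {a b p q} → a ∷ p ≈ₚ b ∷ q → p ≈ₚ q
    ∷-injectiveʳ e .coeff≈ i = coeff≈ e (suc i)

    0∷[] : ∀ {a p} → a ≈ 0# → p ≈ₚ [] → a ∷ p ≈ₚ []
    0∷[] a≈0 p≈[] .coeff≈ zero    = a≈0
    0∷[] a≈0 p≈[] .coeff≈ (suc i) = coeff≈ p≈[] i

    ·-cong : ∀ {a b p q} → a ≈ b → p ≈ₚ q → a ·ₚ p ≈ₚ b ·ₚ q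
    ·-cong {a} {b} {p} {q} a≈b p≈q .coeff≈ i =
      trans (coeff-· a p i) (trans (*-cong a≈b (coeff≈ p≈q i)) (sym (coeff-· b q i)))

    ·-zeroˡ : ∀ {a} p → a ≈ 0# → a ·ₚ p ≈ₚ []
    ·-zeroˡ {a} p a≈0 .coeff≈ i =
      trans (coeff-· a p i) (trans (*-congʳ a≈0) (zeroˡ _))

    ·-identity : ∀ p → 1# ·ₚ p ≈ₚ p
    ·-identity p .coeff≈ i = trans (coeff-· 1# p i) (*-identityˡ _)

    ·-assoc : ∀ a b p → (a * b) ·ₚ p ≈ₚ a ·ₚ (b ·ₚ p)
    ·-assoc a b p .coeff≈ i = begin
      coeff ((a * b) ·ₚ p) i  ≈⟨ coeff-· (a * b) p i ⟩
      a * b * coeff p i       ≈⟨ *-assoc a b _ ⟩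
      a * (b * coeff p i)     ≈⟨ *-congˡ (coeff-· b p i) ⟨
      a * coeff (b ·ₚ p) i    ≈⟨ coeff-· a (b ·ₚ p) i ⟨
      coeff (a ·ₚ (b ·ₚ p)) i ∎
      where open SetoidReasoning setoid

    ·-distribʳ : ∀ p a b → (a + b) ·ₚ p ≈ₚ a ·ₚ p +ₚ b ·ₚ p
    ·-distribʳ p a b .coeff≈ i = begin
      coeff ((a + b) ·ₚ p) i                ≈⟨ coeff-· (a + b) p i ⟩
      (a + b) * coeff p i                   ≈⟨ distribʳ _ a b ⟩
      a * coeff p i + b * coeff p i         ≈⟨ +-cong (coeff-· a p i) (coeff-· b p i) ⟨
      coeff (a ·ₚ p) i + coeff (b ·ₚ p) i   ≈⟨ coeff-+ (a ·ₚ p) (b ·ₚ p) i ⟨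
      coeff (a ·ₚ p +ₚ b ·ₚ p) i            ∎
      where open SetoidReasoning setoid

    ·-distribˡ : ∀ a p q → a ·ₚ (p +ₚ q) ≈ₚ a ·ₚ p +ₚ a ·ₚ q
    ·-distribˡ a p q .coeff≈ i = begin
      coeff (a ·ₚ (p +ₚ q)) i               ≈⟨ coeff-· a (p +ₚ q) i ⟩
      a * coeff (p +ₚ q) i                  ≈⟨ *-congˡ (coeff-+ p q i) ⟩
      a * (coeff p i + coeff q i)           ≈⟨ distribˡ a _ _ ⟩
      a * coeff p i + a * coeff q i         ≈⟨ +-cong (coeff-· a p i) (coeff-· a q i) ⟨
      coeff (a ·ₚ p) i + coeff (a ·ₚ q) i   ≈⟨ coeff-+ (a ·ₚ p) (a ·ₚ q) i ⟨
      coeff (a ·ₚ p +ₚ a ·ₚ q) i            ∎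
      where open SetoidReasoning setoid

    *ₚ-zeroˡ : ∀ {p} q → p ≈ₚ [] → p *ₚ q ≈ₚ []
    *ₚ-zeroˡ {[]}    q p≈[] = +ₚ.refl
    *ₚ-zeroˡ {a ∷ p} q p≈[] =
      +ₚ.∙-cong (·-zeroˡ q (coeff≈ p≈[] 0))
                (0∷[] refl (*ₚ-zeroˡ {p} q (mk≈ (coeff≈ p≈[] ∘ suc))))

    *ₚ-congʳ : ∀ {p q} r → p ≈ₚ q → p *ₚ r ≈ₚ q *ₚ r
    *ₚ-congʳ {[]}    {q}     r p≈q = +ₚ.sym (*ₚ-zeroˡ r (+ₚ.sym p≈q))
    *ₚ-congʳ {a ∷ p} {[]}    r p≈q = *ₚ-zeroˡ r p≈q
    *ₚ-congʳ {a ∷ p} {b ∷ q} r p≈q =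
      +ₚ.∙-cong (·-cong {p = r} (coeff≈ p≈q 0) +ₚ.refl)
                (∷-cong refl (*ₚ-congʳ r (∷-injectiveʳ p≈q)))

    *ₚ-zeroʳ : ∀ p → p *ₚ [] ≈ₚ []
    *ₚ-zeroʳ []      = +ₚ.refl
    *ₚ-zeroʳ (a ∷ p) = 0∷[] refl (*ₚ-zeroʳ p)

    *ₚ-∷ : ∀ p b q → p *ₚ (b ∷ q) ≈ₚ b ·ₚ p +ₚ (0# ∷ p *ₚ q)
    *ₚ-∷ []      b q = +ₚ.sym (0∷[] refl +ₚ.refl)
    *ₚ-∷ (a ∷ p) b q = ∷-cong (+-congʳ (*-comm a b)) (begin
      a ·ₚ q +ₚ p *ₚ (b ∷ q)             ≈⟨ +ₚ.∙-congˡ {x = a ·ₚ q} (*ₚ-∷ p b q) ⟩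
      a ·ₚ q +ₚ (b ·ₚ p +ₚ (0# ∷ p *ₚ q)) ≈⟨ x∙yz≈y∙xz (a ·ₚ q) (b ·ₚ p) _ ⟩
      b ·ₚ p +ₚ (a ·ₚ q +ₚ (0# ∷ p *ₚ q)) ∎)
      where open ≈ₚ-Reasoning

    *ₚ-comm : ∀ p q → p *ₚ q ≈ₚ q *ₚ p
    *ₚ-comm []      q = +ₚ.sym (*ₚ-zeroʳ q)
    *ₚ-comm (a ∷ p) q = begin
      a ·ₚ q +ₚ (0# ∷ p *ₚ q)  ≈⟨ +ₚ.∙-congˡ {x = a ·ₚ q} (∷-cong refl (*ₚ-comm p q)) ⟩
      a ·ₚ q +ₚ (0# ∷ q *ₚ p)  ≈⟨ *ₚ-∷ q a p ⟨
      q *ₚ (a ∷ p)             ∎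
      where open ≈ₚ-Reasoning

    *ₚ-cong : ∀ {p q r s} → p ≈ₚ q → r ≈ₚ s → p *ₚ r ≈ₚ q *ₚ s
    *ₚ-cong {p} {q} {r} {s} p≈q r≈s = begin
      p *ₚ r  ≈⟨ *ₚ-congʳ r p≈q ⟩
      q *ₚ r  ≈⟨ *ₚ-comm q r ⟩
      r *ₚ q  ≈⟨ *ₚ-congʳ q r≈s ⟩
      s *ₚ q  ≈⟨ *ₚ-comm s q ⟩
      q *ₚ s  ∎
      where open ≈ₚ-Reasoning

    *ₚ-distribʳ : ∀ r p q → (p +ₚ q) *ₚ r ≈ₚ p *ₚ r +ₚ q *ₚ r
    *ₚ-distribʳ r []      q       = +ₚ.refl
    *ₚ-distribʳ r (a ∷ p) []      = +ₚ.sym (+ₚ.identityʳ _)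
    *ₚ-distribʳ r (a ∷ p) (b ∷ q) = begin
      (a + b) ·ₚ r +ₚ (0# ∷ (p +ₚ q) *ₚ r)
        ≈⟨ +ₚ.∙-cong (·-distribʳ r a b)
                     (∷-cong (sym (+-identityˡ 0#)) (*ₚ-distribʳ r p q)) ⟩
      (a ·ₚ r +ₚ b ·ₚ r) +ₚ ((0# ∷ p *ₚ r) +ₚ (0# ∷ q *ₚ r))
        ≈⟨ interchange (a ·ₚ r) (b ·ₚ r) _ _ ⟩
      (a ·ₚ r +ₚ (0# ∷ p *ₚ r)) +ₚ (b ·ₚ r +ₚ (0# ∷ q *ₚ r)) ∎
      where open ≈ₚ-Reasoning

    *ₚ-distribˡ : ∀ r p q → r *ₚ (p +ₚ q) ≈ₚ r *ₚ p +ₚ r *ₚ q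
    *ₚ-distribˡ r p q = begin
      r *ₚ (p +ₚ q)       ≈⟨ *ₚ-comm r (p +ₚ q) ⟩
      (p +ₚ q) *ₚ r       ≈⟨ *ₚ-distribʳ r p q ⟩
      p *ₚ r +ₚ q *ₚ r    ≈⟨ +ₚ.∙-cong (*ₚ-comm p r) (*ₚ-comm q r) ⟩
      r *ₚ p +ₚ r *ₚ q    ∎
      where open ≈ₚ-Reasoning

    ·-*ₚ : ∀ a p q → (a ·ₚ p) *ₚ q ≈ₚ a ·ₚ (p *ₚ q)
    ·-*ₚ a []      q = +ₚ.refl
    ·-*ₚ a (b ∷ p) q = begin
      (a * b) ·ₚ q +ₚ (0# ∷ (a ·ₚ p) *ₚ q)
        ≈⟨ +ₚ.∙-cong (·-assoc a b q) (∷-cong (sym (zeroʳ a)) (·-*ₚ a p q)) ⟩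
      a ·ₚ (b ·ₚ q) +ₚ a ·ₚ (0# ∷ p *ₚ q)
        ≈⟨ ·-distribˡ a (b ·ₚ q) (0# ∷ p *ₚ q) ⟨
      a ·ₚ (b ·ₚ q +ₚ (0# ∷ p *ₚ q)) ∎
      where open ≈ₚ-Reasoning

    *ₚ-assoc : ∀ p q r → (p *ₚ q) *ₚ r ≈ₚ p *ₚ (q *ₚ r)
    *ₚ-assoc []      q r = +ₚ.refl
    *ₚ-assoc (a ∷ p) q r = begin
      (a ·ₚ q +ₚ (0# ∷ p *ₚ q)) *ₚ r
        ≈⟨ *ₚ-distribʳ r (a ·ₚ q) (0# ∷ p *ₚ q) ⟩
      (a ·ₚ q) *ₚ r +ₚ (0# ·ₚ r +ₚ (0# ∷ (p *ₚ q) *ₚ r))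
        ≈⟨ +ₚ.∙-cong (·-*ₚ a q r)
                     (+ₚ.∙-cong (·-zeroˡ r refl) (∷-cong refl (*ₚ-assoc p q r))) ⟩
      a ·ₚ (q *ₚ r) +ₚ (0# ∷ p *ₚ (q *ₚ r)) ∎
      where open ≈ₚ-Reasoning

    *ₚ-identityˡ : ∀ p → C 1# *ₚ p ≈ₚ p
    *ₚ-identityˡ p = begin
      1# ·ₚ p +ₚ (0# ∷ [])  ≈⟨ +ₚ.∙-cong (·-identity p) (0∷[] refl +ₚ.refl) ⟩
      p +ₚ []               ≈⟨ +ₚ.identityʳ p ⟩
      p                     ∎
      where open ≈ₚ-Reasoning

  isCommutativeRingₚ : IsCommutativeRing _≈ₚ_ _+ₚ_ _*ₚ_ -ₚ_ [] (C 1#)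
  isCommutativeRingₚ = record
    { isRing = record
      { +-isAbelianGroup = +ₚ-isAbelianGroup
      ; *-cong           = *ₚ-cong
      ; *-assoc          = *ₚ-assoc
      ; *-identity       = *ₚ-identityˡ , λ p → +ₚ.trans (*ₚ-comm p (C 1#)) (*ₚ-identityˡ p)
      ; distrib          = *ₚ-distribˡ , *ₚ-distribʳ
      }
    ; *-comm = *ₚ-comm
    }

  commutativeRing : CommutativeRing c ℓ
  commutativeRing = record { isCommutativeRing = isCommutativeRingₚ }

module PowerSeries {c ℓ} (R : CommutativeRing c ℓ) where

  open CommutativeRing R
  open Sum semiring using (sum)
  open Mult semiring using () renaming (_×_ to _×#_)

  Series : Set c
  Series = ℕ → Carrier

  infix  4 _≋_
  infixl 6 _-ₛ_
  infixl 7 _*ₛ_ _·ₛ_ _/ₛ_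

  _≋_ : Rel Series ℓ
  f ≋ g = ∀ n → f n ≈ g n

  1ₛ : Series
  1ₛ zero    = 1#
  1ₛ (suc n) = 0#

  _-ₛ_ : Series → Series → Series
  (f -ₛ g) n = f n - g n

  _·ₛ_ : Carrier → Series → Series
  (a ·ₛ f) n = a * f n

  _*ₛ_ : Series → Series → Series
  (f *ₛ g) n = sum {suc n} λ i → f (toℕ i) * g (n ∸ toℕ i)

  ∂ : Series → Series
  ∂ f n = suc n ×# f (suc n)

  -- Long division by a series with constant coefficient 1.  Writing
  -- f = f₀ + x f⁺ and g = 1 + x g⁺, the quotient is
  -- f / g = f₀ + x ((f⁺ - f₀ g⁺) / g).  For other divisors the value need
  -- not be a quotient; see /ₛ-*ₛ and /ₛ-unique.

  _/ₛ_ : Series → Series → Series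
  (f /ₛ g) zero    = f 0
  (f /ₛ g) (suc n) = ((λ k → f (suc k) - f 0 * g (suc k)) /ₛ g) n

  /ₛ-*ₛ : ∀ f g → g 0 ≈ 1# → (f /ₛ g) *ₛ g ≋ f
  /ₛ-*ₛ f g g₀≈1 zero = begin
    f 0 * g 0 + 0#  ≈⟨ +-identityʳ _ ⟩
    f 0 * g 0       ≈⟨ *-congˡ g₀≈1 ⟩
    f 0 * 1#        ≈⟨ *-identityʳ _ ⟩
    f 0             ∎
    where open SetoidReasoning setoid
  /ₛ-*ₛ f g g₀≈1 (suc n) = begin
    f₀g + ((f⁺ /ₛ g) *ₛ g) n    ≈⟨ +-congˡ (/ₛ-*ₛ f⁺ g g₀≈1 n) ⟩
    f₀g + (f (suc n) - f₀g)     ≈⟨ +-assoc f₀g _ _ ⟨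
    f₀g + f (suc n) - f₀g       ≈⟨ xyx⁻¹≈y f₀g (f (suc n)) ⟩
    f (suc n)                   ∎
    where
    open SetoidReasoning setoid
    open RingProperties ring using (xyx⁻¹≈y)
    f₀g = f 0 * g (suc n)
    f⁺ : Series
    f⁺ k = f (suc k) - f 0 * g (suc k)

  /ₛ-unique : ∀ f g h → g 0 ≈ 1# → h *ₛ g ≋ f → h ≋ f /ₛ g
  /ₛ-unique f g h g₀≈1 hg≋f zero = begin
    h 0             ≈⟨ *-identityʳ _ ⟨
    h 0 * 1#        ≈⟨ *-congˡ g₀≈1 ⟨
    h 0 * g 0       ≈⟨ +-identityʳ _ ⟨
    h 0 * g 0 + 0#  ≈⟨ hg≋f 0 ⟩
    f 0             ∎
    where open SetoidReasoning setoid
  /ₛ-unique f g h g₀≈1 hg≋f (suc n) =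
    /ₛ-unique _ g (h ∘ suc) g₀≈1 tail n
    where
    open SetoidReasoning setoid
    open RingProperties ring using (xyx⁻¹≈y)
    tail : (h ∘ suc) *ₛ g ≋ λ k → f (suc k) - f 0 * g (suc k)
    tail k = begin
      ((h ∘ suc) *ₛ g) k                      ≈⟨ xyx⁻¹≈y h₀g _ ⟨
      h₀g + ((h ∘ suc) *ₛ g) k - h₀g          ≈⟨ +-cong (hg≋f (suc k)) (-‿cong (*-congʳ h₀≈f₀)) ⟩
      f (suc k) - f 0 * g (suc k)             ∎
      where
      h₀g = h 0 * g (suc k)
      h₀≈f₀ = /ₛ-unique f g h g₀≈1 hg≋f 0

  1-a·f-unital : ∀ a f → f 0 ≈ 0# → (1ₛ -ₛ a ·ₛ f) 0 ≈ 1#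
  1-a·f-unital a f f₀≈0 = begin
    1# - a * f 0  ≈⟨ +-congˡ (-‿cong (trans (*-congˡ f₀≈0) (zeroʳ a))) ⟩
    1# - 0#       ≈⟨ +-congˡ -0#≈0# ⟩
    1# + 0#       ≈⟨ +-identityʳ 1# ⟩
    1#            ∎
    where
    open SetoidReasoning setoid
    open RingProperties ring using (-0#≈0#)

module _ {a} {A : Set a} where

  insertions : A → List A → List (List A)
  insertions x []       = (x ∷ []) ∷ []
  insertions x (y ∷ ys) = (x ∷ y ∷ ys) ∷ map (y ∷_) (insertions x ys)

  permutations : List A → List (List A)
  permutations []       = [] ∷ []
  permutations (x ∷ xs) = concatMap (insertions x) (permutations xs)

  private
    data Insert (x : A) : List A → List A → Set a where
      head : ∀ {ys} → Insert x ys (x ∷ ys)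
      tail : ∀ {y ys zs} → Insert x ys zs → Insert x (y ∷ ys) (y ∷ zs)

    insertions⁻ : ∀ {x zs} ys → zs ∈ insertions x ys → Insert x ys zs
    insertions⁻ []       (here ≡.refl) = head
    insertions⁻ (y ∷ ys) (here ≡.refl) = head
    insertions⁻ (y ∷ ys) (there zs∈) with ∈-map⁻ (y ∷_) zs∈
    ... | _ , zs∈′ , ≡.refl = tail (insertions⁻ ys zs∈′)

    insertions⁺ : ∀ {x ys zs} → Insert x ys zs → zs ∈ insertions x ys
    insertions⁺ {ys = []}    head     = here ≡.refl
    insertions⁺ {ys = _ ∷ _} head     = here ≡.refl
    insertions⁺              (tail i) = there (∈-map⁺ _ (insertions⁺ i))

    insert-↭ : ∀ {x ys zs} → Insert x ys zs → zs ↭ x ∷ ys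
    insert-↭ head     = ↭-refl
    insert-↭ (tail i) = ↭-trans (prep _ (insert-↭ i)) (swap _ _ ↭-refl)

    insert-++ : ∀ x σ τ → Insert x (σ ++ τ) (σ ++ x ∷ τ)
    insert-++ x []      τ = head
    insert-++ x (_ ∷ σ) τ = tail (insert-++ x σ τ)

    insert-functional : ∀ {x ys ys′ zs} → x ∉ ys → x ∉ ys′ →
                        Insert x ys zs → Insert x ys′ zs → ys ≡ ys′
    insert-functional x∉ x∉′ head     head      = ≡.refl
    insert-functional x∉ x∉′ head     (tail _)  = contradiction (here ≡.refl) x∉′
    insert-functional x∉ x∉′ (tail _) head      = contradiction (here ≡.refl) x∉
    insert-functional x∉ x∉′ (tail i) (tail i′) =
      ≡.cong (_ ∷_) (insert-functional (x∉ ∘ there) (x∉′ ∘ there) i i′)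

    permutations⁻ : ∀ xs {π} → π ∈ permutations xs → π ↭ xs
    permutations⁻ []       (here ≡.refl) = ↭-refl
    permutations⁻ (x ∷ xs) π∈
      with ρ , ρ∈ , π∈′ ← find (∈-concatMap⁻ (insertions x) {xs = permutations xs} π∈) =
      ↭-trans (insert-↭ (insertions⁻ ρ π∈′)) (prep x (permutations⁻ xs ρ∈))

    permutations⁺ : ∀ xs {π} → π ↭ xs → π ∈ permutations xs
    permutations⁺ []       π↭ = here (↭-empty-inv π↭)
    permutations⁺ (x ∷ xs) π↭
      with σ , τ , ≡.refl ← ∈-∃++ (∈-resp-↭ (↭-sym π↭) (here ≡.refl)) =
      ∈-concatMap⁺ (insertions x)
        (lose (permutations⁺ xs (drop-mid σ [] π↭)) (insertions⁺ (insert-++ x σ τ)))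

    insertions-unique : ∀ {x} ys → x ∉ ys → Unique (insertions x ys)
    insertions-unique []       x∉ = [] ∷ []
    insertions-unique (y ∷ ys) x∉ =
      All.map⁺ (All.tabulate λ { _ ≡.refl → x∉ (here ≡.refl) })
      ∷ Unique.map⁺ (λ { ≡.refl → ≡.refl }) (insertions-unique ys (x∉ ∘ there))

    concatMap-insertions-unique : ∀ {x} πs → All (x ∉_) πs → Unique πs →
                                  Unique (concatMap (insertions x) πs)
    concatMap-insertions-unique     []       _         _          = []
    concatMap-insertions-unique {x} (π ∷ πs) (x∉ ∷ x∉s) (π∉ ∷ uniq) =
      Unique.++⁺ (insertions-unique π x∉) (concatMap-insertions-unique πs x∉s uniq) disjoint
      where
      disjoint : ∀ {zs} → zs ∈ insertions x π × zs ∈ concatMap (insertions x) πs → _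
      disjoint (zs∈ , zs∈′)
        with ρ , ρ∈ , zs∈ρ ← find (∈-concatMap⁻ (insertions x) {xs = πs} zs∈′) =
        All.lookup π∉ ρ∈ (insert-functional x∉ (All.lookup x∉s ρ∈)
                           (insertions⁻ π zs∈) (insertions⁻ ρ zs∈ρ))

  ∈-permutations : ∀ xs {π} → π ∈ permutations xs ⇔ (π ↭ xs)
  ∈-permutations xs = mk⇔ (permutations⁻ xs) (permutations⁺ xs)

  permutations-unique : ∀ xs → Unique xs → Unique (permutations xs)
  permutations-unique []       _           = [] ∷ []
  permutations-unique (x ∷ xs) (x∉ ∷ uniq) =
    concatMap-insertions-unique (permutations xs)
      (All.tabulate λ π∈ → All¬⇒¬Any x∉ ∘ ∈-resp-↭ (permutations⁻ xs π∈))
      (permutations-unique xs uniq)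

-- The permutations of 1,…,n: complete by ∈-permutations, without repetition
-- by 𝔖-unique.
𝔖 : ℕ → List (List ℕ)
𝔖 n = permutations (applyDownFrom suc n)

𝔖-unique : ∀ n → Unique (𝔖 n)
𝔖-unique n = permutations-unique _
  (Unique.applyDownFrom⁺₁ suc n λ j<i _ → ℕ.<⇒≢ j<i ∘ ≡.sym ∘ ℕ.suc-injective)

-- Each letter together with its two neighbours, where π₀ = πₙ₊₁ = ∞.

Window : Set
Window = ℕ ⁺ × ℕ ⁺ × ℕ ⁺

windows : List (ℕ ⁺) → List Window
windows (a ∷ b ∷ c ∷ l) = (a , b , c) ∷ windows (b ∷ c ∷ l)
windows _               = []

letters : List ℕ → List Window
letters π = windows (⊤⁺ ∷ map [_] π ∷ʳ ⊤⁺)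

Peak DoubleAscent DoubleDescent : Pred Window 0ℓ
Peak          (a , b , c) = a <⁺ b × c <⁺ b
DoubleAscent  (a , b , c) = a <⁺ b × b <⁺ c
DoubleDescent (a , b , c) = b <⁺ a × c <⁺ b

_<⁺?_ : ∀ a b → Dec (a <⁺ b)
_<⁺?_ = <⁺-dec ℕ._<?_

peak? : Decidable Peak
peak? (a , b , c) = (a <⁺? b) ×-dec (c <⁺? b)

doubleAscent? : Decidable DoubleAscent
doubleAscent? (a , b , c) = (a <⁺? b) ×-dec (b <⁺? c)

doubleDescent? : Decidable DoubleDescent
doubleDescent? (a , b , c) = (b <⁺? a) ×-dec (c <⁺? b)

pk dbl : List ℕ → ℕ
pk  π = length (filter peak? (letters π))
dbl π = length (filter doubleAscent? (letters π))
  ℕ.+ length (filter doubleDescent? (letters π))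

module Polyₛ = Polynomial ℚ.+-*-commutativeRing

ℚ[s] : CommutativeRing 0ℓ 0ℓ
ℚ[s] = Polyₛ.commutativeRing

module Polyₜ = Polynomial ℚ[s]

ℚ[s,t] : CommutativeRing 0ℓ 0ℓ
ℚ[s,t] = Polyₜ.commutativeRing

open CommutativeRing ℚ[s,t] using (Carrier; _≈_; _+_; _*_; _-_; 0#; 1#; semiring)
open Exp semiring using (_^_)
open Mult semiring using () renaming (_×_ to _×#_)
open PowerSeries ℚ[s,t] public

const : ℚ → Carrier
const q = Polyₜ.C (Polyₛ.C q)

s t : Carrier
s = Polyₜ.C Polyₛ.X
t = Polyₜ.X

1/_! : ℕ → ℚ
1/ n ! = (+ 1) ℚ./ (n !)
  where instance _ = n ℕ.!≢0

permutationPolynomial : ℕ → Carrier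
permutationPolynomial n = foldr _+_ 0# (map (λ π → s ^ pk π * t ^ dbl π) (𝔖 n))

P : Series
P zero    = 0#
P (suc n) = const (1/ suc n !) * permutationPolynomial (suc n)

U : ℕ → Carrier
U 0             = 1#
U 1             = 2 ×# t
U (suc (suc n)) = (2 ×# t) * U (suc n) - s * U n

V : Series
V 0             = 0#
V 1             = 0#
V (suc (suc n)) = const (1/ suc (suc n) !) * U n

-- The denominator is a legitimate divisor for _/ₛ_.
1-sV₀ : (1ₛ -ₛ s ·ₛ V) 0 ≈ 1#
1-sV₀ = 1-a·f-unital s V (CommutativeRing.refl ℚ[s,t] {0#})

{-# OPTIONS --safe #-}
module Submission where

-- Cutting a permutation π = σ n τ at its maximum n, which acts like the boundary value ∞ for
-- both σ and τ, gives P′ = 1 + 2t P + s P²: the letter n is a peak if σ and τ are nonempty, a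
-- double ascent or descent if exactly one of them is, and a valley if neither is.  The
-- Chebyshev recurrence reads V″ = 1 + 2t V′ - s V with V(0) = V′(0) = 0, and then V′ / (1 - s V)
-- satisfies the same Riccati equation as P.

open import Algebra.Bundles using (CommutativeRing)
import Algebra.Properties.AbelianGroup as AbelianGroupProperties
import Algebra.Properties.CommutativeMonoid.Mult as CommutativeMonoidMult
import Algebra.Properties.Monoid.Mult as MonoidMult
import Algebra.Properties.Ring as RingProperties
import Algebra.Properties.Semiring.Exp as Exp
import Algebra.Properties.Semiring.Mult as Mult
import Algebra.Solver.Ring.NaturalCoefficients.Default as Solver
open import Data.Integer.Base using (+_)
import Data.Integer.Properties as ℤ
import Data.Integer.Solver as ℤSolver
open import Data.List.Base
  using (List; []; _∷_; _++_; _∷ʳ_; map; concatMap; foldr; filter; length; applyDownFrom)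
open import Data.List.Membership.Propositional using (_∈_)
open import Data.List.Properties using (map-∘; filter-accept; filter-reject; length-applyDownFrom)
open import Data.List.Relation.Binary.Permutation.Propositional using (_↭_; ↭-sym)
open import Data.List.Relation.Binary.Permutation.Propositional.Properties
  using (All-resp-↭; ¬x∷xs↭[])
open import Data.List.Relation.Binary.Sublist.Propositional as Sublist using (_⊆_; []; _∷_)
open import Data.List.Relation.Binary.Sublist.Propositional.Properties
  using (All-resp-⊆; length-mono-≤)
open import Data.List.Relation.Unary.All using (All; []; _∷_)
import Data.List.Relation.Unary.All.Properties as All
open import Data.List.Relation.Unary.AllPairs using (AllPairs; []; _∷_)
import Data.List.Relation.Unary.AllPairs.Properties as AllPairs
open import Data.List.Relation.Unary.Any using (here; there)
open import Data.Nat.Base as ℕ using (ℕ; zero; suc; _!; _≤_; z≤n; s≤s)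
import Data.Nat.Properties as ℕ
open import Data.Nat.Solver using (module +-*-Solver)
open import Data.Product.Base using (_,_)
open import Data.Product.Function.NonDependent.Propositional using (_×-⇔_)
import Data.Rational.Base as ℚ
import Data.Rational.Properties as ℚ
open import Data.Rational.Unnormalised.Base as ℚᵘ using (mkℚᵘ; *≡*)
import Data.Rational.Unnormalised.Properties as ℚᵘ
open import Function.Base using (_∘_)
open import Function.Bundles using (_⇔_; mk⇔; Equivalence)
open import Function.Construct.Identity using (⇔-id)
open import Level using (0ℓ)
open import Relation.Binary.Construct.Add.Supremum.Strict (ℕ._<_)
  using (_<⁺_; [_]; [_]<⊤⁺; <⁺-asym)
open import Relation.Binary.PropositionalEquality as ≡ using (_≡_)
import Relation.Binary.Reasoning.Setoid as SetoidReasoning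
open import Relation.Nullary.Construct.Add.Supremum using (_⁺; ⊤⁺; [_])
open import Relation.Nullary.Decidable using (yes; no)
open import Relation.Nullary.Negation using (¬_; contradiction)
open import Relation.Unary using (Pred; Decidable)

open import Defs using
  ( module PowerSeries; insertions; permutations; ∈-permutations
  ; Window; windows; letters; peak?; doubleAscent?; doubleDescent?; pk; dbl
  ; ℚ[s,t]; module Polyₛ; module Polyₜ; const; 1/_! )

-- Comparing two solutions of the Riccati equation would mean differentiating a quotient and proving
-- uniqueness. The proof avoids both by showing P = V′ + sPV coefficient by coefficient. If this
-- holds through degree k, substituting it into τP and into one factor of P² turns P′ = 1 + τP +
-- sP², with τ = 2t, into V″ + s(P′V + PV′). That is the derivative of the right-hand side, so the
-- identity reaches degree k+1.
--
-- The computation takes place on sequences of coefficients multiplied by n!. There differentiation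
-- is a shift and the product is given by the Leibniz rule, so no binomial coefficients occur.
-- Inverse factorials enter only in passing between these sequences and the series.
--
-- On the combinatorial side, the pieces of a cut word use arbitrary sets of letters, not initial
-- segments of the integers. No relabelling is carried out: the recurrence is proved for every
-- decreasing list of letters, and it expresses each sum of weights through sums over shorter lists,
-- hence through the length alone.

-- Products of exponential generating functions

module BinomialConvolution {c ℓ} (R : CommutativeRing c ℓ) where

  open CommutativeRing R
  open PowerSeries R
  open Mult semiring using (×-comm-*) renaming (_×_ to _×#_)
  open MonoidMult +-monoid using (×-congʳ; ×-assocˡ)
  open CommutativeMonoidMult +-commutativeMonoid using (×-distrib-+)
  open Solver commutativeSemiring using (solve; con; _:=_; _:+_; _:*_)
  open SetoidReasoning setoid

  infixl 6 _+ₛ_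
  infixl 7 _⊛_

  _+ₛ_ : Series → Series → Series
  (f +ₛ g) n = f n + g n

  -- The product of exponential generating functions, defined through the Leibniz rule:
  -- (f ⊛ g) n = Σₖ C(n,k) f(k) g(n-k).
  _⊛_ : Series → Series → Series
  (f ⊛ g) zero    = f 0 * g 0
  (f ⊛ g) (suc n) = ((f ∘ suc) ⊛ g) n + (f ⊛ (g ∘ suc)) n

  -- Coefficient `n` of a product reads its factors only up to index `n`. This locality allows an
  -- induction hypothesis known only up to `n` to be applied inside a product.
  ⊛-cong-≤ : ∀ {f f′ g g′} n → (∀ k → k ≤ n → f k ≈ f′ k) → (∀ k → k ≤ n → g k ≈ g′ k) →
             (f ⊛ g) n ≈ (f′ ⊛ g′) n
  ⊛-cong-≤ zero    f≈ g≈ = *-cong (f≈ 0 z≤n) (g≈ 0 z≤n)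
  ⊛-cong-≤ (suc n) f≈ g≈ = +-cong
    (⊛-cong-≤ n (λ k k≤n → f≈ (suc k) (s≤s k≤n)) (λ k k≤n → g≈ k (ℕ.m≤n⇒m≤1+n k≤n)))
    (⊛-cong-≤ n (λ k k≤n → f≈ k (ℕ.m≤n⇒m≤1+n k≤n)) (λ k k≤n → g≈ (suc k) (s≤s k≤n)))

  ⊛-cong : ∀ {f f′ g g′} → f ≋ f′ → g ≋ g′ → f ⊛ g ≋ f′ ⊛ g′
  ⊛-cong f≈ g≈ n = ⊛-cong-≤ n (λ k _ → f≈ k) (λ k _ → g≈ k)

  ⊛-comm : ∀ f g → f ⊛ g ≋ g ⊛ f
  ⊛-comm f g zero    = *-comm _ _
  ⊛-comm f g (suc n) = trans (+-cong (⊛-comm (f ∘ suc) g n) (⊛-comm f (g ∘ suc) n)) (+-comm _ _)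

  ⊛-distribˡ : ∀ f g h → f ⊛ (g +ₛ h) ≋ (f ⊛ g) +ₛ (f ⊛ h)
  ⊛-distribˡ f g h zero    = distribˡ _ _ _
  ⊛-distribˡ f g h (suc n) = trans
    (+-cong (⊛-distribˡ (f ∘ suc) g h n) (⊛-distribˡ f (g ∘ suc) (h ∘ suc) n))
    (solve 4 (λ a b c d → (a :+ b) :+ (c :+ d) := (a :+ c) :+ (b :+ d)) refl _ _ _ _)

  ⊛-distribʳ : ∀ h f g → (f +ₛ g) ⊛ h ≋ (f ⊛ h) +ₛ (g ⊛ h)
  ⊛-distribʳ h f g n = begin
    ((f +ₛ g) ⊛ h) n         ≈⟨ ⊛-comm (f +ₛ g) h n ⟩
    (h ⊛ (f +ₛ g)) n         ≈⟨ ⊛-distribˡ h f g n ⟩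
    (h ⊛ f) n + (h ⊛ g) n    ≈⟨ +-cong (⊛-comm h f n) (⊛-comm h g n) ⟩
    (f ⊛ h) n + (g ⊛ h) n    ∎

  -- Both sides have the derivative f′gh + fg′h + fgh′, so induction on the degree suffices.
  ⊛-assoc : ∀ f g h → (f ⊛ g) ⊛ h ≋ f ⊛ (g ⊛ h)
  ⊛-assoc f g h zero    = *-assoc _ _ _
  ⊛-assoc f g h (suc n) = begin
    (((f⁺ ⊛ g) +ₛ (f ⊛ g⁺)) ⊛ h) n + ((f ⊛ g) ⊛ h⁺) n
      ≈⟨ +-congʳ (⊛-distribʳ h (f⁺ ⊛ g) (f ⊛ g⁺) n) ⟩
    ((f⁺ ⊛ g) ⊛ h) n + ((f ⊛ g⁺) ⊛ h) n + ((f ⊛ g) ⊛ h⁺) n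
      ≈⟨ +-cong (+-cong (⊛-assoc f⁺ g h n) (⊛-assoc f g⁺ h n)) (⊛-assoc f g h⁺ n) ⟩
    (f⁺ ⊛ (g ⊛ h)) n + (f ⊛ (g⁺ ⊛ h)) n + (f ⊛ (g ⊛ h⁺)) n
      ≈⟨ +-assoc _ _ _ ⟩
    (f⁺ ⊛ (g ⊛ h)) n + ((f ⊛ (g⁺ ⊛ h)) n + (f ⊛ (g ⊛ h⁺)) n)
      ≈⟨ +-congˡ (⊛-distribˡ f (g⁺ ⊛ h) (g ⊛ h⁺) n) ⟨
    (f⁺ ⊛ (g ⊛ h)) n + (f ⊛ ((g⁺ ⊛ h) +ₛ (g ⊛ h⁺))) n ∎
    where
    f⁺ = f ∘ suc
    g⁺ = g ∘ suc
    h⁺ = h ∘ suc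

  ⊛-·ˡ : ∀ a f g → (a ·ₛ f) ⊛ g ≋ a ·ₛ (f ⊛ g)
  ⊛-·ˡ a f g zero    = *-assoc _ _ _
  ⊛-·ˡ a f g (suc n) =
    trans (+-cong (⊛-·ˡ a (f ∘ suc) g n) (⊛-·ˡ a f (g ∘ suc) n)) (sym (distribˡ _ _ _))

  ⊛-·ʳ : ∀ a f g → f ⊛ (a ·ₛ g) ≋ a ·ₛ (f ⊛ g)
  ⊛-·ʳ a f g n = begin
    (f ⊛ (a ·ₛ g)) n    ≈⟨ ⊛-comm f (a ·ₛ g) n ⟩
    ((a ·ₛ g) ⊛ f) n    ≈⟨ ⊛-·ˡ a g f n ⟩
    a * (g ⊛ f) n       ≈⟨ *-congˡ (⊛-comm g f n) ⟩
    a * (f ⊛ g) n       ∎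

  ⊛-zeroˡ : ∀ f → (λ _ → 0#) ⊛ f ≋ λ _ → 0#
  ⊛-zeroˡ f zero    = zeroˡ _
  ⊛-zeroˡ f (suc n) = trans (+-cong (⊛-zeroˡ f n) (⊛-zeroˡ (f ∘ suc) n)) (+-identityˡ 0#)

  ⊛-identityˡ : ∀ f → 1ₛ ⊛ f ≋ f
  ⊛-identityˡ f zero    = *-identityˡ _
  ⊛-identityˡ f (suc n) =
    trans (+-cong (⊛-zeroˡ f n) (⊛-identityˡ (f ∘ suc) n)) (+-identityˡ _)

  ⊛-identityʳ : ∀ f → f ⊛ 1ₛ ≋ f
  ⊛-identityʳ f n = trans (⊛-comm f 1ₛ n) (⊛-identityˡ f n)

  *ₛ-distribʳ : ∀ h f g → (f +ₛ g) *ₛ h ≋ (f *ₛ h) +ₛ (g *ₛ h)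
  *ₛ-distribʳ h f g zero    = solve 3
    (λ a b c → (a :+ b) :* c :+ con 0 := (a :* c :+ con 0) :+ (b :* c :+ con 0)) refl _ _ _
  *ₛ-distribʳ h f g (suc n) = trans
    (+-congˡ (*ₛ-distribʳ h (f ∘ suc) (g ∘ suc) n))
    (solve 5 (λ a b c d e → (a :+ b) :* c :+ (d :+ e) := (a :* c :+ d) :+ (b :* c :+ e))
      refl _ _ _ _ _)

  -- Write f = f₀ + x f⁺; the Cauchy product unfolds accordingly. Of the `n + 2` copies of the
  -- coefficient of f⁺g, one is split off and the rest form a derivative, which is the rule (xh)′ =
  -- h + xh′.
  ∂-*ₛ : ∀ f g → ∂ (f *ₛ g) ≋ (∂ f *ₛ g) +ₛ (f *ₛ ∂ g)
  ∂-*ₛ f g zero    = solve 4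
    (λ a b c d → (a :* b :+ (c :* d :+ con 0)) :+ con 0
              := ((c :+ con 0) :* d :+ con 0) :+ (a :* (b :+ con 0) :+ con 0))
    refl (f 0) (g 1) (f 1) (g 0)
  ∂-*ₛ f g (suc n) = begin
    suc (suc n) ×# (f 0 * g (2 ℕ.+ n) + (f⁺ *ₛ g) (suc n))
      ≈⟨ ×-distrib-+ _ _ (suc (suc n)) ⟩
    suc (suc n) ×# (f 0 * g (2 ℕ.+ n)) + ((f⁺ *ₛ g) (suc n) + ∂ (f⁺ *ₛ g) n)
      ≈⟨ +-cong (sym (×-comm-* (suc (suc n)) _ _)) (+-congˡ (∂-*ₛ f⁺ g n)) ⟩
    f 0 * ∂ g (suc n) + ((f 1 * g (suc n) + (f⁺⁺ *ₛ g) n) + ((∂ f⁺ *ₛ g) n + (f⁺ *ₛ ∂ g) n))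
      ≈⟨ solve 5 (λ a b c d e → a :+ ((b :+ c) :+ (d :+ e)) := (b :+ (c :+ d)) :+ (a :+ e))
           refl _ _ _ _ _ ⟩
    (f 1 * g (suc n) + ((f⁺⁺ *ₛ g) n + (∂ f⁺ *ₛ g) n)) + (f 0 * ∂ g (suc n) + (f⁺ *ₛ ∂ g) n)
      ≈⟨ +-congʳ (+-cong (*-congʳ (sym (+-identityʳ _))) (sym (*ₛ-distribʳ g f⁺⁺ (∂ f⁺) n))) ⟩
    (∂ f *ₛ g) (suc n) + (f *ₛ ∂ g) (suc n) ∎
    where
    f⁺ = f ∘ suc
    f⁺⁺ = f⁺ ∘ suc

  egf⁻¹ : Series → Series
  egf⁻¹ f n = (n !) ×# f n

  egf⁻¹-∂ : ∀ f → egf⁻¹ (∂ f) ≋ egf⁻¹ f ∘ suc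
  egf⁻¹-∂ f n = trans (×-assocˡ (f (suc n)) (n !) (suc n))
    (reflexive (≡.cong (_×# f (suc n)) (ℕ.*-comm (n !) (suc n))))

  -- Both products obey the Leibniz rule, and `egf⁻¹` turns `∂` into a shift, so agreement in degree
  -- `n` carries over to degree `n + 1`.
  egf⁻¹-*ₛ : ∀ f g → egf⁻¹ (f *ₛ g) ≋ egf⁻¹ f ⊛ egf⁻¹ g
  egf⁻¹-*ₛ f g zero    = solve 2
    (λ a b → a :* b :+ con 0 :+ con 0 := (a :+ con 0) :* (b :+ con 0)) refl (f 0) (g 0)
  egf⁻¹-*ₛ f g (suc n) = begin
    egf⁻¹ (f *ₛ g) (suc n)
      ≈⟨ egf⁻¹-∂ (f *ₛ g) n ⟨
    (n !) ×# ∂ (f *ₛ g) n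
      ≈⟨ ×-congʳ (n !) (∂-*ₛ f g n) ⟩
    (n !) ×# ((∂ f *ₛ g) n + (f *ₛ ∂ g) n)
      ≈⟨ ×-distrib-+ _ _ (n !) ⟩
    egf⁻¹ (∂ f *ₛ g) n + egf⁻¹ (f *ₛ ∂ g) n
      ≈⟨ +-cong (egf⁻¹-*ₛ (∂ f) g n) (egf⁻¹-*ₛ f (∂ g) n) ⟩
    (egf⁻¹ (∂ f) ⊛ egf⁻¹ g) n + (egf⁻¹ f ⊛ egf⁻¹ (∂ g)) n
      ≈⟨ +-cong (⊛-cong (egf⁻¹-∂ f) (λ _ → refl) n) (⊛-cong (λ _ → refl) (egf⁻¹-∂ g) n) ⟩
    (egf⁻¹ f ⊛ egf⁻¹ g) (suc n) ∎

-- From the Riccati equation to the quotient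

module Riccati {c ℓ} (R : CommutativeRing c ℓ) where

  open CommutativeRing R
  open PowerSeries R
  open BinomialConvolution R
  open Mult semiring using (×-assoc-*; ×-comm-*) renaming (_×_ to _×#_)
  open MonoidMult +-monoid using (×-congʳ)
  open CommutativeMonoidMult +-commutativeMonoid using (×-distrib-+)
  open RingProperties ring using (+-cancelʳ)
  open AbelianGroupProperties +-abelianGroup using (//-rightDividesˡ)
  open Solver commutativeSemiring using (solve; con; _:=_; _:+_; _:*_)
  open SetoidReasoning setoid

  module _ (s τ : Carrier) (a v : Series)
           (a₀≈0 : a 0 ≈ 0#) (a′ : a ∘ suc ≋ 1ₛ +ₛ ((τ ·ₛ a) +ₛ (s ·ₛ (a ⊛ a))))
           (v₀≈0 : v 0 ≈ 0#) (v₁≈0 : v 1 ≈ 0#)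
           (v″ : ((v ∘ suc) ∘ suc) +ₛ (s ·ₛ v) ≋ 1ₛ +ₛ (τ ·ₛ (v ∘ suc))) where

    -- The linear relation a = v′ + s a v, by strong induction on the degree. The bound `n` makes
    -- the recursion structural while giving the hypothesis at every index up to `k`, as the product
    -- in degree `k` demands.
    linearised-≤ : ∀ n k → k ≤ n → a k ≈ v (suc k) + s * (a ⊛ v) k
    linearised-≤ n       zero    _         = begin
      a 0                        ≈⟨ a₀≈0 ⟩
      0#                         ≈⟨ solve 2 (λ s a → con 0 := con 0 :+ s :* (a :* con 0)) refl s (a 0) ⟩
      0# + s * (a 0 * 0#)        ≈⟨ +-cong (sym v₁≈0) (*-congˡ (*-congˡ (sym v₀≈0))) ⟩
      v 1 + s * (a 0 * v 0)      ∎
    linearised-≤ (suc n) (suc k) (s≤s k≤n) = begin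
      a (suc k)
        ≈⟨ a′ k ⟩
      1ₛ k + (τ * a k + s * (a ⊛ a) k)
        ≈⟨ +-congˡ (+-cong (*-congˡ (ih k ℕ.≤-refl)) (*-congˡ (begin
             (a ⊛ a) k
               -- Only one of the two factors is expanded; the other is kept in order to rebuild a′v
               -- below.
               ≈⟨ ⊛-cong-≤ k (λ _ _ → refl) ih ⟩
             (a ⊛ ((v ∘ suc) +ₛ (s ·ₛ (a ⊛ v)))) k
               ≈⟨ ⊛-distribˡ a (v ∘ suc) (s ·ₛ (a ⊛ v)) k ⟩
             (a ⊛ (v ∘ suc)) k + (a ⊛ (s ·ₛ (a ⊛ v))) k
               ≈⟨ +-congˡ (⊛-·ʳ s a (a ⊛ v) k) ⟩
             (a ⊛ (v ∘ suc)) k + s * (a ⊛ (a ⊛ v)) k ∎))) ⟩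
      1ₛ k + (τ * (v (suc k) + s * (a ⊛ v) k) + s * ((a ⊛ (v ∘ suc)) k + s * (a ⊛ (a ⊛ v)) k))
        ≈⟨ solve 7 (λ s τ o v′ p q r → o :+ (τ :* (v′ :+ s :* p) :+ s :* (q :+ s :* r))
                                    := (o :+ τ :* v′) :+ s :* ((τ :* p :+ s :* r) :+ q))
             refl s τ (1ₛ k) _ _ _ _ ⟩
      (1ₛ k + τ * v (suc k)) + s * ((τ * (a ⊛ v) k + s * (a ⊛ (a ⊛ v)) k) + (a ⊛ (v ∘ suc)) k)
        ≈⟨ +-congʳ (sym (v″ k)) ⟩
      (v (2 ℕ.+ k) + s * v k) + s * ((τ * (a ⊛ v) k + s * (a ⊛ (a ⊛ v)) k) + (a ⊛ (v ∘ suc)) k)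
        ≈⟨ solve 5 (λ v″ s v x q → (v″ :+ s :* v) :+ s :* (x :+ q) := v″ :+ s :* ((v :+ x) :+ q))
             refl _ _ _ _ _ ⟩
      v (2 ℕ.+ k) + s * ((v k + (τ * (a ⊛ v) k + s * (a ⊛ (a ⊛ v)) k)) + (a ⊛ (v ∘ suc)) k)
        -- The bracket is (1 + τa + sa²)v, which is a′v by the Riccati equation. Together with av′
        -- it forms the derivative of av.
        ≈⟨ +-congˡ (*-congˡ (+-congʳ (begin
             v k + (τ * (a ⊛ v) k + s * (a ⊛ (a ⊛ v)) k)
               ≈⟨ +-cong (⊛-identityˡ v k) (+-cong (⊛-·ˡ τ a v k)
                    (trans (⊛-·ˡ s (a ⊛ a) v k) (*-congˡ (⊛-assoc a a v k)))) ⟨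
             (1ₛ ⊛ v) k + (((τ ·ₛ a) ⊛ v) k + ((s ·ₛ (a ⊛ a)) ⊛ v) k)
               ≈⟨ +-congˡ (⊛-distribʳ v (τ ·ₛ a) (s ·ₛ (a ⊛ a)) k) ⟨
             (1ₛ ⊛ v) k + (((τ ·ₛ a) +ₛ (s ·ₛ (a ⊛ a))) ⊛ v) k
               ≈⟨ ⊛-distribʳ v 1ₛ _ k ⟨
             ((1ₛ +ₛ ((τ ·ₛ a) +ₛ (s ·ₛ (a ⊛ a)))) ⊛ v) k
               ≈⟨ ⊛-cong a′ (λ _ → refl) k ⟨
             ((a ∘ suc) ⊛ v) k ∎))) ⟩
      v (2 ℕ.+ k) + s * (((a ∘ suc) ⊛ v) k + (a ⊛ (v ∘ suc)) k) ∎
      where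
      ih : ∀ j → j ≤ k → a j ≈ v (suc j) + s * (a ⊛ v) j
      ih j j≤k = linearised-≤ n j (ℕ.≤-trans j≤k k≤n)

    -- Multiplying g + sv = 1 by `a` gives ag + s a v = a, and comparison with the linear relation
    -- cancels s a v. Describing the denominator by an equation instead of a difference keeps the
    -- computation free of subtraction.
    ⊛-unital-part : ∀ g → g +ₛ (s ·ₛ v) ≋ 1ₛ → a ⊛ g ≋ v ∘ suc
    ⊛-unital-part g g+sv≈1 n = +-cancelʳ (s * (a ⊛ v) n) _ _ (begin
      (a ⊛ g) n + s * (a ⊛ v) n           ≈⟨ +-congˡ (⊛-·ʳ s a v n) ⟨
      (a ⊛ g) n + (a ⊛ (s ·ₛ v)) n        ≈⟨ ⊛-distribˡ a g (s ·ₛ v) n ⟨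
      (a ⊛ (g +ₛ (s ·ₛ v))) n             ≈⟨ ⊛-cong (λ _ → refl) g+sv≈1 n ⟩
      (a ⊛ 1ₛ) n                          ≈⟨ ⊛-identityʳ a n ⟩
      a n                                 ≈⟨ linearised-≤ n n ℕ.≤-refl ⟩
      v (suc n) + s * (a ⊛ v) n           ∎)

  egf⁻¹-1ₛ : egf⁻¹ 1ₛ ≋ 1ₛ
  egf⁻¹-1ₛ zero    = +-identityʳ 1#
  egf⁻¹-1ₛ (suc n) = ×-zeroʳ (suc n !)
    where
    ×-zeroʳ : ∀ m → m ×# 0# ≈ 0#
    ×-zeroʳ zero    = refl
    ×-zeroʳ (suc m) = trans (+-identityˡ _) (×-zeroʳ m)

  -- The series `e` is the exponential series: its coefficients are the inverses of the factorials,
  -- and the hypothesis on it is the only divisibility required of the ring.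
  !-cancel : (e : Series) → egf⁻¹ e ≋ (λ _ → 1#) → ∀ {f g} → egf⁻¹ f ≋ egf⁻¹ g → f ≋ g
  !-cancel e e≈ {f} {g} f≈g n = begin
    f n                      ≈⟨ *-identityˡ _ ⟨
    1# * f n                 ≈⟨ *-congʳ (e≈ n) ⟨
    ((n !) ×# e n) * f n     ≈⟨ ×-assoc-* (n !) _ _ ⟩
    (n !) ×# (e n * f n)     ≈⟨ ×-comm-* (n !) _ _ ⟨
    e n * ((n !) ×# f n)     ≈⟨ *-congˡ (f≈g n) ⟩
    e n * ((n !) ×# g n)     ≈⟨ ×-comm-* (n !) _ _ ⟩
    (n !) ×# (e n * g n)     ≈⟨ ×-assoc-* (n !) _ _ ⟨
    ((n !) ×# e n) * g n     ≈⟨ *-congʳ (e≈ n) ⟩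
    1# * g n                 ≈⟨ *-identityˡ _ ⟩
    g n                      ∎

  riccati : ∀ (e : Series) → egf⁻¹ e ≋ (λ _ → 1#) →
            ∀ s τ {f w a v} → egf⁻¹ f ≋ a → egf⁻¹ w ≋ v →
            a 0 ≈ 0# → a ∘ suc ≋ 1ₛ +ₛ ((τ ·ₛ a) +ₛ (s ·ₛ (a ⊛ a))) →
            v 0 ≈ 0# → v 1 ≈ 0# →
            ((v ∘ suc) ∘ suc) +ₛ (s ·ₛ v) ≋ 1ₛ +ₛ (τ ·ₛ (v ∘ suc)) →
            f ≋ ∂ w /ₛ (1ₛ -ₛ s ·ₛ w)
  riccati e e≈ s τ {f} {w} {a} {v} f≈a w≈v a₀≈0 a′ v₀≈0 v₁≈0 v″ =
    /ₛ-unique (∂ w) g f (1-a·f-unital s w w₀≈0) (!-cancel e e≈ λ n → begin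
      egf⁻¹ (f *ₛ g) n          ≈⟨ egf⁻¹-*ₛ f g n ⟩
      (egf⁻¹ f ⊛ egf⁻¹ g) n     ≈⟨ ⊛-cong f≈a (λ _ → refl) n ⟩
      (a ⊛ egf⁻¹ g) n           ≈⟨ ⊛-unital-part s τ a v a₀≈0 a′ v₀≈0 v₁≈0 v″ (egf⁻¹ g) g+sv≈1 n ⟩
      v (suc n)                 ≈⟨ w≈v (suc n) ⟨
      egf⁻¹ w (suc n)           ≈⟨ egf⁻¹-∂ w n ⟨
      egf⁻¹ (∂ w) n             ∎)
    where
    g : Series
    g = 1ₛ -ₛ s ·ₛ w
    w₀≈0 : w 0 ≈ 0#
    w₀≈0 = trans (sym (+-identityʳ _)) (trans (w≈v 0) v₀≈0)
    g+sv≈1 : egf⁻¹ g +ₛ (s ·ₛ v) ≋ 1ₛ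
    g+sv≈1 n = begin
      (n !) ×# g n + s * v n              ≈⟨ +-congˡ (*-congˡ (w≈v n)) ⟨
      (n !) ×# g n + s * ((n !) ×# w n)   ≈⟨ +-congˡ (×-comm-* (n !) _ _) ⟩
      (n !) ×# g n + (n !) ×# (s * w n)   ≈⟨ ×-distrib-+ _ _ (n !) ⟨
      (n !) ×# (g n + s * w n)            ≈⟨ ×-congʳ (n !) (//-rightDividesˡ (s * w n) (1ₛ n)) ⟩
      (n !) ×# 1ₛ n                       ≈⟨ egf⁻¹-1ₛ n ⟩
      1ₛ n                                ∎

-- Sums over permutations, cuts and bipartitions

module ListSum {c ℓ} (R : CommutativeRing c ℓ) where

  open CommutativeRing R
  open PowerSeries R using (Series)
  open BinomialConvolution R using (_⊛_)
  open Solver commutativeSemiring using (solve; con; _:=_; _:+_)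
  open SetoidReasoning setoid

  module _ {a} {A : Set a} where

    ∑ : List A → (A → Carrier) → Carrier
    ∑ xs f = foldr _+_ 0# (map f xs)

    ∑-cong-∈ : ∀ xs {f g} → (∀ {x} → x ∈ xs → f x ≈ g x) → ∑ xs f ≈ ∑ xs g
    ∑-cong-∈ []       f≈g = refl
    ∑-cong-∈ (x ∷ xs) f≈g = +-cong (f≈g (here ≡.refl)) (∑-cong-∈ xs (f≈g ∘ there))

    ∑-cong : ∀ xs {f g} → (∀ x → f x ≈ g x) → ∑ xs f ≈ ∑ xs g
    ∑-cong xs f≈g = ∑-cong-∈ xs (λ {x} _ → f≈g x)

    ∑-+ : ∀ xs f g → ∑ xs (λ x → f x + g x) ≈ ∑ xs f + ∑ xs g
    ∑-+ []       f g = sym (+-identityʳ 0#)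
    ∑-+ (x ∷ xs) f g = trans (+-congˡ (∑-+ xs f g))
      (solve 4 (λ a b c d → (a :+ b) :+ (c :+ d) := (a :+ c) :+ (b :+ d)) refl _ _ _ _)

    ∑-*ʳ : ∀ xs a f → ∑ xs (λ x → f x * a) ≈ ∑ xs f * a
    ∑-*ʳ []       a f = sym (zeroˡ a)
    ∑-*ʳ (x ∷ xs) a f = trans (+-congˡ (∑-*ʳ xs a f)) (sym (distribʳ a _ _))

    ∑-*ˡ : ∀ xs a f → ∑ xs (λ x → a * f x) ≈ a * ∑ xs f
    ∑-*ˡ xs a f = begin
      ∑ xs (λ x → a * f x)   ≈⟨ ∑-cong xs (λ x → *-comm a (f x)) ⟩
      ∑ xs (λ x → f x * a)   ≈⟨ ∑-*ʳ xs a f ⟩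
      ∑ xs f * a             ≈⟨ *-comm _ a ⟩
      a * ∑ xs f             ∎

    ∑-++ : ∀ xs ys f → ∑ (xs ++ ys) f ≈ ∑ xs f + ∑ ys f
    ∑-++ []       ys f = sym (+-identityˡ _)
    ∑-++ (x ∷ xs) ys f = trans (+-congˡ (∑-++ xs ys f)) (sym (+-assoc _ _ _))

  module _ {a b} {A : Set a} {B : Set b} where

    ∑-map : ∀ (g : B → A) xs f → ∑ (map g xs) f ≈ ∑ xs (f ∘ g)
    ∑-map g xs f = reflexive (≡.cong (foldr _+_ 0#) (≡.sym (map-∘ xs)))

    ∑-concatMap : ∀ (g : B → List A) xs f →
                  ∑ (concatMap g xs) f ≈ ∑ xs (λ x → ∑ (g x) f)
    ∑-concatMap g []       f = refl
    ∑-concatMap g (x ∷ xs) f =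
      trans (∑-++ (g x) (concatMap g xs) f) (+-congˡ (∑-concatMap g xs f))

  module _ {a} {A : Set a} where

    ∑-factors : List A → (List A → List A → Carrier) → Carrier
    ∑-factors []      h = h [] []
    ∑-factors (y ∷ ρ) h = h [] (y ∷ ρ) + ∑-factors ρ (λ σ τ → h (y ∷ σ) τ)

    -- Each letter goes left or right. The recursion is shaped like the Leibniz rule defining `⊛`,
    -- so no list of subsets has to be built.
    ∑-bipartitions : List A → (List A → List A → Carrier) → Carrier
    ∑-bipartitions []       h = h [] []
    ∑-bipartitions (x ∷ xs) h =
      ∑-bipartitions xs (λ ys zs → h (x ∷ ys) zs) + ∑-bipartitions xs (λ ys zs → h ys (x ∷ zs))

    ∑-factors-cong : ∀ ρ {h k} → (∀ σ τ → σ ++ τ ≡ ρ → h σ τ ≈ k σ τ) →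
                     ∑-factors ρ h ≈ ∑-factors ρ k
    ∑-factors-cong []      h≈k = h≈k [] [] ≡.refl
    ∑-factors-cong (y ∷ ρ) h≈k = +-cong (h≈k [] (y ∷ ρ) ≡.refl)
      (∑-factors-cong ρ (λ σ τ eq → h≈k (y ∷ σ) τ (≡.cong (y ∷_) eq)))

    ∑-factors-+ : ∀ ρ h k → ∑-factors ρ (λ σ τ → h σ τ + k σ τ) ≈ ∑-factors ρ h + ∑-factors ρ k
    ∑-factors-+ []      h k = refl
    ∑-factors-+ (y ∷ ρ) h k = trans (+-congˡ (∑-factors-+ ρ _ _))
      (solve 4 (λ a b c d → (a :+ b) :+ (c :+ d) := (a :+ c) :+ (b :+ d)) refl _ _ _ _)

    ∑-factors-*ˡ : ∀ ρ a h → ∑-factors ρ (λ σ τ → a * h σ τ) ≈ a * ∑-factors ρ h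
    ∑-factors-*ˡ []      a h = refl
    ∑-factors-*ˡ (y ∷ ρ) a h = trans (+-congˡ (∑-factors-*ˡ ρ a _)) (sym (distribˡ a _ _))

    ∑-bipartitions-cong : ∀ xs {h k} → (∀ {ys zs} → ys ⊆ xs → zs ⊆ xs → h ys zs ≈ k ys zs) →
                          ∑-bipartitions xs h ≈ ∑-bipartitions xs k
    ∑-bipartitions-cong []       h≈k = h≈k [] []
    ∑-bipartitions-cong (x ∷ xs) h≈k = +-cong
      (∑-bipartitions-cong xs (λ ys⊆ zs⊆ → h≈k (≡.refl ∷ ys⊆) (x Sublist.∷ʳ zs⊆)))
      (∑-bipartitions-cong xs (λ ys⊆ zs⊆ → h≈k (x Sublist.∷ʳ ys⊆) (≡.refl ∷ zs⊆)))

    -- Sending the first letter left shifts `f`, and sending it right shifts `g`: these are the two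
    -- terms of the Leibniz rule.
    ∑-bipartitions-⊛ : ∀ xs (f g : Series) →
      ∑-bipartitions xs (λ ys zs → f (length ys) * g (length zs)) ≈ (f ⊛ g) (length xs)
    ∑-bipartitions-⊛ []       f g = refl
    ∑-bipartitions-⊛ (x ∷ xs) f g =
      +-cong (∑-bipartitions-⊛ xs (f ∘ suc) g) (∑-bipartitions-⊛ xs f (g ∘ suc))

    ∑-insertions : ∀ (x : A) ρ f → ∑ (insertions x ρ) f ≈ ∑-factors ρ (λ σ τ → f (σ ++ x ∷ τ))
    ∑-insertions x []      f = +-identityʳ _
    ∑-insertions x (y ∷ ρ) f = +-congˡ (trans (∑-map (y ∷_) (insertions x ρ) f)
      (∑-insertions x ρ (f ∘ (y ∷_))))

    -- After inserting `x` and cutting, `x` lies on exactly one side of the cut. Deleting it leaves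
    -- a cut of `ρ` together with a place for `x` in one of the two pieces.
    ∑-insertions-factors : ∀ (x : A) ρ h →
      ∑ (insertions x ρ) (λ ρ′ → ∑-factors ρ′ h) ≈
      ∑-factors ρ (λ σ τ → ∑ (insertions x σ) (λ σ′ → h σ′ τ) + ∑ (insertions x τ) (h σ))
    ∑-insertions-factors x []      h = solve 2
      (λ a b → (a :+ b) :+ con 0 := (b :+ con 0) :+ (a :+ con 0)) refl _ _
    ∑-insertions-factors x (y ∷ ρ) h = begin
      (h [] (x ∷ y ∷ ρ) + (h (x ∷ []) (y ∷ ρ) + ∑-factors ρ (λ σ → h (x ∷ y ∷ σ))))
        + ∑ (map (y ∷_) (insertions x ρ)) (λ ρ′ → ∑-factors ρ′ h)
        ≈⟨ +-congˡ (trans (∑-map (y ∷_) (insertions x ρ) _) (trans (∑-+ (insertions x ρ) _ _)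
             (+-congˡ (∑-insertions-factors x ρ (λ σ → h (y ∷ σ)))))) ⟩
      (h [] (x ∷ y ∷ ρ) + (h (x ∷ []) (y ∷ ρ) + ∑-factors ρ (λ σ → h (x ∷ y ∷ σ))))
        + (∑ (insertions x ρ) (λ ρ′ → h [] (y ∷ ρ′))
        + ∑-factors ρ (λ σ τ → ∑ (insertions x σ) (λ σ′ → h (y ∷ σ′) τ) + ∑ (insertions x τ) (h (y ∷ σ))))
        ≈⟨ solve 5 (λ a b c d e → (a :+ (b :+ c)) :+ (d :+ e) := ((b :+ con 0) :+ (a :+ d)) :+ (c :+ e))
             refl _ _ _ _ _ ⟩
      ((h (x ∷ []) (y ∷ ρ) + 0#) + (h [] (x ∷ y ∷ ρ) + ∑ (insertions x ρ) (λ ρ′ → h [] (y ∷ ρ′))))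
        + (∑-factors ρ (λ σ → h (x ∷ y ∷ σ))
        + ∑-factors ρ (λ σ τ → ∑ (insertions x σ) (λ σ′ → h (y ∷ σ′) τ) + ∑ (insertions x τ) (h (y ∷ σ))))
        ≈⟨ +-cong (+-congˡ (+-congˡ (∑-map (y ∷_) (insertions x ρ) _)))
             (trans (∑-factors-cong ρ (λ σ τ _ → trans
                (+-congʳ (+-congˡ (∑-map (y ∷_) (insertions x σ) _))) (+-assoc _ _ _)))
               (∑-factors-+ ρ _ _)) ⟨
      (∑ (insertions x []) (λ σ′ → h σ′ (y ∷ ρ)) + ∑ (insertions x (y ∷ ρ)) (h []))
        + ∑-factors ρ (λ σ τ → ∑ (insertions x (y ∷ σ)) (λ σ′ → h σ′ τ)
                             + ∑ (insertions x τ) (h (y ∷ σ))) ∎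

    ∑-permutations : ∀ (x : A) xs f →
      ∑ (permutations (x ∷ xs)) f ≈ ∑ (permutations xs) (λ ρ → ∑ (insertions x ρ) f)
    ∑-permutations x xs f = ∑-concatMap (insertions x) (permutations xs) f

    -- To permute xs and cut the result in two is to choose which letters go to the left, and
    -- then to permute the two sets of letters independently.
    ∑-permutations-factors : ∀ (xs : List A) f g →
      ∑ (permutations xs) (λ ρ → ∑-factors ρ (λ σ τ → f σ * g τ)) ≈
      ∑-bipartitions xs (λ ys zs → ∑ (permutations ys) f * ∑ (permutations zs) g)
    ∑-permutations-factors []       f g = trans (+-identityʳ _)
      (*-cong (sym (+-identityʳ _)) (sym (+-identityʳ _)))
    ∑-permutations-factors (x ∷ xs) f g = begin
      ∑ (permutations (x ∷ xs)) (λ ρ → ∑-factors ρ fg)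
        ≈⟨ ∑-permutations x xs _ ⟩
      ∑ (permutations xs) (λ ρ → ∑ (insertions x ρ) (λ ρ′ → ∑-factors ρ′ fg))
        ≈⟨ ∑-cong (permutations xs) (λ ρ → begin
             ∑ (insertions x ρ) (λ ρ′ → ∑-factors ρ′ fg)
               ≈⟨ ∑-insertions-factors x ρ fg ⟩
             ∑-factors ρ (λ σ τ → ∑ (insertions x σ) (λ σ′ → f σ′ * g τ)
                                + ∑ (insertions x τ) (λ τ′ → f σ * g τ′))
               ≈⟨ ∑-factors-cong ρ (λ σ τ _ → +-cong (∑-*ʳ (insertions x σ) (g τ) f)
                                                     (∑-*ˡ (insertions x τ) (f σ) g)) ⟩
             ∑-factors ρ (λ σ τ → inserted f σ * g τ + f σ * inserted g τ)
               ≈⟨ ∑-factors-+ ρ _ _ ⟩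
             ∑-factors ρ (λ σ τ → inserted f σ * g τ) + ∑-factors ρ (λ σ τ → f σ * inserted g τ) ∎) ⟩
      ∑ (permutations xs) (λ ρ → ∑-factors ρ (λ σ τ → inserted f σ * g τ)
                               + ∑-factors ρ (λ σ τ → f σ * inserted g τ))
        ≈⟨ ∑-+ (permutations xs) _ _ ⟩
      ∑ (permutations xs) (λ ρ → ∑-factors ρ (λ σ τ → inserted f σ * g τ))
        + ∑ (permutations xs) (λ ρ → ∑-factors ρ (λ σ τ → f σ * inserted g τ))
        ≈⟨ +-cong (∑-permutations-factors xs (inserted f) g)
                  (∑-permutations-factors xs f (inserted g)) ⟩
      ∑-bipartitions xs (λ ys zs → ∑ (permutations ys) (inserted f) * ∑ (permutations zs) g)
        + ∑-bipartitions xs (λ ys zs → ∑ (permutations ys) f * ∑ (permutations zs) (inserted g))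
        ≈⟨ +-cong
             (∑-bipartitions-cong xs (λ {ys} _ _ → *-congʳ (∑-permutations x ys f)))
             (∑-bipartitions-cong xs (λ {zs = zs} _ _ → *-congˡ (∑-permutations x zs g))) ⟨
      ∑-bipartitions xs (λ ys zs → ∑ (permutations (x ∷ ys)) f * ∑ (permutations zs) g)
        + ∑-bipartitions xs (λ ys zs → ∑ (permutations ys) f * ∑ (permutations (x ∷ zs)) g) ∎
      where
      fg : List A → List A → Carrier
      fg σ τ = f σ * g τ
      inserted : (List A → Carrier) → List A → Carrier
      inserted k ρ = ∑ (insertions x ρ) k

-- Letter statistics around a maximal letter

last⁺ : ℕ ⁺ → List ℕ → ℕ ⁺
last⁺ l []      = l
last⁺ l (b ∷ σ) = last⁺ [ b ] σ

head⁺ : List ℕ → ℕ ⁺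
head⁺ []      = ⊤⁺
head⁺ (y ∷ _) = [ y ]

last⁺-< : ∀ {l x} σ → l <⁺ [ x ] → All (ℕ._< x) σ → last⁺ l σ <⁺ [ x ]
last⁺-< []      l<x []          = l<x
last⁺-< (b ∷ σ) _   (b<x ∷ σ<x) = last⁺-< σ [ b<x ] σ<x

-- The left neighbour is freed from the value ∞ used in `letters`, so that induction can move along
-- the word.
lettersAfter : ℕ ⁺ → List ℕ → List Window
lettersAfter l π = windows (l ∷ map [_] π ∷ʳ ⊤⁺)

lettersAfter-∷ : ∀ l x τ → lettersAfter l (x ∷ τ) ≡ (l , [ x ] , head⁺ τ) ∷ lettersAfter [ x ] τ
lettersAfter-∷ l x []      = ≡.refl
lettersAfter-∷ l x (_ ∷ _) = ≡.refl

<x⇔<⊤⁺ : ∀ {b x} → b ℕ.< x → ([ b ] <⁺ [ x ]) ⇔ ([ b ] <⁺ ⊤⁺)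
<x⇔<⊤⁺ b<x = mk⇔ (λ _ → [ _ ]<⊤⁺) (λ _ → [ b<x ])

x<⇔⊤⁺< : ∀ {b x} → b ℕ.< x → ([ x ] <⁺ [ b ]) ⇔ (⊤⁺ <⁺ [ b ])
x<⇔⊤⁺< b<x = mk⇔ (λ { [ x<b ] → contradiction x<b (ℕ.<-asym b<x) }) (λ ())

-- A maximal letter x cuts the word like the boundary value ∞ for any statistic that, in the
-- window of a letter b < x, does not distinguish a neighbour x from a neighbour ∞.

module MaximalLetter
  {P : Pred Window 0ℓ} (P? : Decidable P)
  (left  : ∀ {b x c} → b ℕ.< x → P ([ x ] , [ b ] , c) ⇔ P (⊤⁺ , [ b ] , c))
  (right : ∀ {a b x} → b ℕ.< x → P (a , [ b ] , [ x ]) ⇔ P (a , [ b ] , ⊤⁺)) where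

  open ≡.≡-Reasoning

  count : List Window → ℕ
  count ws = length (filter P? ws)

  [_]? : Window → ℕ
  [ w ]? = count (w ∷ [])

  count-∷ : ∀ w ws → count (w ∷ ws) ≡ [ w ]? ℕ.+ count ws
  count-∷ w ws with P? w
  ... | yes _ = ≡.refl
  ... | no  _ = ≡.refl

  []?-accept : ∀ w → P w → [ w ]? ≡ 1
  []?-accept w Pw = ≡.cong length (filter-accept P? Pw)

  []?-reject : ∀ w → ¬ P w → [ w ]? ≡ 0
  []?-reject w ¬Pw = ≡.cong length (filter-reject P? ¬Pw)

  []?-cong : ∀ {w w′} → P w ⇔ P w′ → [ w ]? ≡ [ w′ ]?
  []?-cong {w} {w′} eq with P? w
  ... | yes Pw = ≡.sym ([]?-accept w′ (Equivalence.to eq Pw))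
  ... | no ¬Pw = ≡.sym ([]?-reject w′ (¬Pw ∘ Equivalence.from eq))

  count-lettersAfter-∷ : ∀ l x τ →
    count (lettersAfter l (x ∷ τ)) ≡ [ l , [ x ] , head⁺ τ ]? ℕ.+ count (lettersAfter [ x ] τ)
  count-lettersAfter-∷ l x τ = ≡.trans (≡.cong count (lettersAfter-∷ l x τ)) (count-∷ _ _)

  -- Only the first letter of `τ` sees its left boundary, and since it is below `x` it cannot tell
  -- `x` from ∞.
  count-lettersAfter-max : ∀ {x} τ → All (ℕ._< x) τ →
                           count (lettersAfter [ x ] τ) ≡ count (letters τ)
  count-lettersAfter-max []      []        = ≡.refl
  count-lettersAfter-max (y ∷ τ) (y<x ∷ _) = begin
    count (lettersAfter [ _ ] (y ∷ τ))
      ≡⟨ count-lettersAfter-∷ _ y τ ⟩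
    [ [ _ ] , [ y ] , head⁺ τ ]? ℕ.+ count (lettersAfter [ y ] τ)
      ≡⟨ ≡.cong (ℕ._+ _) ([]?-cong (left y<x)) ⟩
    [ ⊤⁺ , [ y ] , head⁺ τ ]? ℕ.+ count (lettersAfter [ y ] τ)
      ≡⟨ count-lettersAfter-∷ ⊤⁺ y τ ⟨
    count (letters (y ∷ τ)) ∎

  []?-head⁺-++ : ∀ l b x σ τ → b ℕ.< x →
                 [ l , [ b ] , head⁺ (σ ++ x ∷ τ) ]? ≡ [ l , [ b ] , head⁺ σ ]?
  []?-head⁺-++ l b x []      τ b<x = []?-cong (right b<x)
  []?-head⁺-++ l b x (_ ∷ _) τ b<x = ≡.refl

  -- Among the letters of `σ`, only the last one sees `x`, in place of the boundary ∞; all other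
  -- windows are unchanged.
  count-lettersAfter-++ : ∀ l {x} σ τ → All (ℕ._< x) σ →
    count (lettersAfter l (σ ++ x ∷ τ)) ≡
    count (lettersAfter l σ) ℕ.+ count (lettersAfter (last⁺ l σ) (x ∷ τ))
  count-lettersAfter-++ l     []      τ []          = ≡.refl
  count-lettersAfter-++ l {x} (b ∷ σ) τ (b<x ∷ σ<x) = begin
    count (lettersAfter l (b ∷ σ ++ x ∷ τ))
      ≡⟨ count-lettersAfter-∷ l b (σ ++ x ∷ τ) ⟩
    [ l , [ b ] , head⁺ (σ ++ x ∷ τ) ]? ℕ.+ count (lettersAfter [ b ] (σ ++ x ∷ τ))
      ≡⟨ ≡.cong₂ ℕ._+_ ([]?-head⁺-++ l b x σ τ b<x) (count-lettersAfter-++ [ b ] σ τ σ<x) ⟩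
    [ l , [ b ] , head⁺ σ ]? ℕ.+ (count (lettersAfter [ b ] σ) ℕ.+ _)
      ≡⟨ ℕ.+-assoc [ l , [ b ] , head⁺ σ ]? _ _ ⟨
    [ l , [ b ] , head⁺ σ ]? ℕ.+ count (lettersAfter [ b ] σ) ℕ.+ _
      ≡⟨ ≡.cong (ℕ._+ count (lettersAfter (last⁺ [ b ] σ) (x ∷ τ))) (count-lettersAfter-∷ l b σ) ⟨
    count (lettersAfter l (b ∷ σ)) ℕ.+ count (lettersAfter (last⁺ [ b ] σ) (x ∷ τ)) ∎

  count-letters-++ : ∀ {x} σ τ → All (ℕ._< x) σ → All (ℕ._< x) τ →
    count (letters (σ ++ x ∷ τ)) ≡
    count (letters σ) ℕ.+ ([ last⁺ ⊤⁺ σ , [ x ] , head⁺ τ ]? ℕ.+ count (letters τ))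
  count-letters-++ {x} σ τ σ<x τ<x = begin
    count (letters (σ ++ x ∷ τ))
      ≡⟨ count-lettersAfter-++ ⊤⁺ σ τ σ<x ⟩
    count (letters σ) ℕ.+ count (lettersAfter (last⁺ ⊤⁺ σ) (x ∷ τ))
      ≡⟨ ≡.cong (count (letters σ) ℕ.+_) (count-lettersAfter-∷ _ x τ) ⟩
    count (letters σ) ℕ.+ ([ last⁺ ⊤⁺ σ , [ x ] , head⁺ τ ]? ℕ.+ count (lettersAfter [ x ] τ))
      ≡⟨ ≡.cong (λ n → count (letters σ) ℕ.+ ([ last⁺ ⊤⁺ σ , [ x ] , head⁺ τ ]? ℕ.+ n))
           (count-lettersAfter-max τ τ<x) ⟩
    count (letters σ) ℕ.+ ([ last⁺ ⊤⁺ σ , [ x ] , head⁺ τ ]? ℕ.+ count (letters τ)) ∎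

module Peaks = MaximalLetter peak?
  (λ b<x → x<⇔⊤⁺< b<x ×-⇔ ⇔-id _)
  (λ b<x → ⇔-id _ ×-⇔ x<⇔⊤⁺< b<x)
module Ascents = MaximalLetter doubleAscent?
  (λ b<x → x<⇔⊤⁺< b<x ×-⇔ ⇔-id _)
  (λ b<x → ⇔-id _ ×-⇔ <x⇔<⊤⁺ b<x)
module Descents = MaximalLetter doubleDescent?
  (λ b<x → <x⇔<⊤⁺ b<x ×-⇔ ⇔-id _)
  (λ b<x → ⇔-id _ ×-⇔ x<⇔⊤⁺< b<x)

-- The recurrence for the weighted sum over permutations

module PeakRecurrence {c ℓ} (R : CommutativeRing c ℓ) (s t : CommutativeRing.Carrier R) where

  open CommutativeRing R
  open PowerSeries R
  open BinomialConvolution R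
  open ListSum R
  open Exp semiring using (_^_; ^-homo-*)
  open Mult semiring using () renaming (_×_ to _×#_)
  open Solver commutativeSemiring using (solve; con; _:=_; _:+_; _:*_)
  open SetoidReasoning setoid

  weight : List ℕ → Carrier
  weight π = s ^ pk π * t ^ dbl π

  centreWeight : Window → Carrier
  centreWeight w = s ^ Peaks.[ w ]? * t ^ (Ascents.[ w ]? ℕ.+ Descents.[ w ]?)

  weight-++ : ∀ {x} σ τ → All (ℕ._< x) σ → All (ℕ._< x) τ →
    weight (σ ++ x ∷ τ) ≈ weight σ * (centreWeight (last⁺ ⊤⁺ σ , [ x ] , head⁺ τ) * weight τ)
  weight-++ {x} σ τ σ<x τ<x = begin
    s ^ pk (σ ++ x ∷ τ) * t ^ dbl (σ ++ x ∷ τ)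
      ≈⟨ *-cong (reflexive (≡.cong (s ^_) (Peaks.count-letters-++ σ τ σ<x τ<x)))
                (reflexive (≡.cong (t ^_) dbl-++)) ⟩
    s ^ (pk σ ℕ.+ (Peaks.[ w ]? ℕ.+ pk τ)) * t ^ (dbl σ ℕ.+ (d ℕ.+ dbl τ))
      ≈⟨ *-cong (homo s (pk σ) Peaks.[ w ]? (pk τ)) (homo t (dbl σ) d (dbl τ)) ⟩
    (s ^ pk σ * (s ^ Peaks.[ w ]? * s ^ pk τ)) * (t ^ dbl σ * (t ^ d * t ^ dbl τ))
      ≈⟨ solve 6 (λ a b c d e f → (a :* (b :* c)) :* (d :* (e :* f))
                               := (a :* d) :* ((b :* e) :* (c :* f))) refl _ _ _ _ _ _ ⟩
    weight σ * (centreWeight w * weight τ) ∎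
    where
    w : Window
    w = last⁺ ⊤⁺ σ , [ x ] , head⁺ τ
    d : ℕ
    d = Ascents.[ w ]? ℕ.+ Descents.[ w ]?
    homo : ∀ a k l m → a ^ (k ℕ.+ (l ℕ.+ m)) ≈ a ^ k * (a ^ l * a ^ m)
    homo a k l m = trans (^-homo-* a k (l ℕ.+ m)) (*-congˡ (^-homo-* a l m))
    open +-*-Solver using () renaming (solve to solveℕ; _:=_ to _:=ℕ_; _:+_ to _:+ℕ_)
    dbl-++ : dbl (σ ++ x ∷ τ) ≡ dbl σ ℕ.+ (d ℕ.+ dbl τ)
    dbl-++ = ≡.trans
      (≡.cong₂ ℕ._+_ (Ascents.count-letters-++ σ τ σ<x τ<x) (Descents.count-letters-++ σ τ σ<x τ<x))
      (solveℕ 6 (λ a b c d e f → (a :+ℕ (b :+ℕ c)) :+ℕ (d :+ℕ (e :+ℕ f))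
                              :=ℕ (a :+ℕ d) :+ℕ ((b :+ℕ e) :+ℕ (c :+ℕ f))) ≡.refl
        (Ascents.count (letters σ)) Ascents.[ w ]? (Ascents.count (letters τ))
        (Descents.count (letters σ)) Descents.[ w ]? (Descents.count (letters τ)))

  centreWeight-≡ : ∀ w {i j k} → Peaks.[ w ]? ≡ i → Ascents.[ w ]? ≡ j → Descents.[ w ]? ≡ k →
                   centreWeight w ≈ s ^ i * t ^ (j ℕ.+ k)
  centreWeight-≡ w ≡.refl ≡.refl ≡.refl = refl

  asym : ∀ {a b} → a <⁺ b → ¬ b <⁺ a
  asym = <⁺-asym ℕ.<-asym

  centreWeight-inner : ∀ {l x r} → l <⁺ [ x ] → r <⁺ [ x ] → centreWeight (l , [ x ] , r) ≈ s
  centreWeight-inner {l} {x} {r} l<x r<x = trans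
    (centreWeight-≡ w (Peaks.[]?-accept w (l<x , r<x))
      (Ascents.[]?-reject w λ (_ , x<r) → asym r<x x<r)
      (Descents.[]?-reject w λ (x<l , _) → asym l<x x<l))
    (solve 1 (λ s → (s :* con 1) :* con 1 := s) refl s)
    where w = l , [ x ] , r

  centreWeight-last : ∀ {l x} → l <⁺ [ x ] → centreWeight (l , [ x ] , ⊤⁺) ≈ t
  centreWeight-last {l} {x} l<x = trans
    (centreWeight-≡ w (Peaks.[]?-reject w λ ()) (Ascents.[]?-accept w (l<x , [ x ]<⊤⁺))
      (Descents.[]?-reject w λ ()))
    (solve 1 (λ t → con 1 :* (t :* con 1) := t) refl t)
    where w = l , [ x ] , ⊤⁺

  centreWeight-first : ∀ {x r} → r <⁺ [ x ] → centreWeight (⊤⁺ , [ x ] , r) ≈ t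
  centreWeight-first {x} {r} r<x = trans
    (centreWeight-≡ w (Peaks.[]?-reject w λ ()) (Ascents.[]?-reject w λ ())
      (Descents.[]?-accept w ([ x ]<⊤⁺ , r<x)))
    (solve 1 (λ t → con 1 :* (t :* con 1) := t) refl t)
    where w = ⊤⁺ , [ x ] , r

  centreWeight-only : ∀ {x} → centreWeight (⊤⁺ , [ x ] , ⊤⁺) ≈ 1#
  centreWeight-only {x} = trans
    (centreWeight-≡ w (Peaks.[]?-reject w λ ()) (Ascents.[]?-reject w λ ())
      (Descents.[]?-reject w λ ()))
    (*-identityʳ 1#)
    where w = ⊤⁺ , [ x ] , ⊤⁺

  -- P has no constant term although the empty word has weight 1, so that weight is split off into
  -- `isEmpty`, whose totals form the unit series.
  nonemptyWeight : List ℕ → Carrier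
  nonemptyWeight []        = 0#
  nonemptyWeight π@(_ ∷ _) = weight π

  isEmpty : List ℕ → Carrier
  isEmpty []      = 1#
  isEmpty (_ ∷ _) = 0#

  -- In each of the four cases of empty or nonempty `σ` and `τ` a single summand survives. The
  -- uniform formula is a combination of products of a function of `σ` and a function of `τ`, the
  -- form that `∑-permutations-factors` can sum.
  weight-max : ∀ {x} σ τ → All (ℕ._< x) σ → All (ℕ._< x) τ →
    let u = nonemptyWeight ; e = isEmpty in
    weight (σ ++ x ∷ τ) ≈ (s * (u σ * u τ) + t * (e σ * u τ + u σ * e τ)) + e σ * e τ
  weight-max {x} [] [] σ<x τ<x = begin
    _                               ≈⟨ weight-++ [] [] σ<x τ<x ⟩
    _                               ≈⟨ *-congˡ (*-congʳ (centreWeight-only {x})) ⟩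
    (1# * 1#) * (1# * (1# * 1#))
      ≈⟨ solve 2 (λ s t → (con 1 :* con 1) :* (con 1 :* (con 1 :* con 1))
                       := (s :* (con 0 :* con 0) :+ t :* (con 1 :* con 0 :+ con 0 :* con 1)) :+ con 1 :* con 1)
           refl s t ⟩
    _                               ∎
  weight-max [] τ@(y ∷ _) σ<x τ<x@(y<x ∷ _) = begin
    _                               ≈⟨ weight-++ [] τ σ<x τ<x ⟩
    _                               ≈⟨ *-congˡ (*-congʳ (centreWeight-first [ y<x ])) ⟩
    (1# * 1#) * (t * weight τ)
      ≈⟨ solve 3 (λ s t b → (con 1 :* con 1) :* (t :* b)
                         := (s :* (con 0 :* b) :+ t :* (con 1 :* b :+ con 0 :* con 0)) :+ con 1 :* con 0)
           refl s t (weight τ) ⟩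
    _                               ∎
  weight-max σ@(_ ∷ σ′) [] σ<x@(b<x ∷ σ′<x) τ<x = begin
    _                               ≈⟨ weight-++ σ [] σ<x τ<x ⟩
    _                               ≈⟨ *-congˡ (*-congʳ (centreWeight-last (last⁺-< σ′ [ b<x ] σ′<x))) ⟩
    weight σ * (t * (1# * 1#))
      ≈⟨ solve 3 (λ s t a → a :* (t :* (con 1 :* con 1))
                         := (s :* (a :* con 0) :+ t :* (con 0 :* con 0 :+ a :* con 1)) :+ con 0 :* con 1)
           refl s t (weight σ) ⟩
    _                               ∎
  weight-max σ@(_ ∷ σ′) τ@(y ∷ _) σ<x@(b<x ∷ σ′<x) τ<x@(y<x ∷ _) = begin
    _                               ≈⟨ weight-++ σ τ σ<x τ<x ⟩
    _                               ≈⟨ *-congˡ (*-congʳ (centreWeight-inner (last⁺-< σ′ [ b<x ] σ′<x) [ y<x ])) ⟩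
    weight σ * (s * weight τ)
      ≈⟨ solve 4 (λ s t a b → a :* (s :* b)
                           := (s :* (a :* b) :+ t :* (con 0 :* b :+ a :* con 0)) :+ con 0 :* con 0)
           refl s t (weight σ) (weight τ) ⟩
    _                               ∎

  ∈-permutations⁻ : ∀ {a} {A : Set a} (xs : List A) {π} → π ∈ permutations xs → π ↭ xs
  ∈-permutations⁻ xs = Equivalence.to (∈-permutations xs)

  -- A permutation of a nonempty list is nonempty, so conventions at the empty word do not affect
  -- the sum.
  ∑-permutations-∷-cong : ∀ x xs {f g : List ℕ → Carrier} → (∀ y ys → f (y ∷ ys) ≈ g (y ∷ ys)) →
    ∑ (permutations (x ∷ xs)) f ≈ ∑ (permutations (x ∷ xs)) g
  ∑-permutations-∷-cong x xs {f} {g} f≈g = ∑-cong-∈ (permutations (x ∷ xs)) λ {π} π∈ →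
    onNonempty π (∈-permutations⁻ (x ∷ xs) π∈)
    where
    onNonempty : ∀ π → π ↭ x ∷ xs → f π ≈ g π
    onNonempty []       []↭ = contradiction (↭-sym []↭) ¬x∷xs↭[]
    onNonempty (y ∷ ys) _   = f≈g y ys

  total : List ℕ → Carrier
  total xs = ∑ (permutations xs) nonemptyWeight

  ∑-isEmpty : ∀ xs → ∑ (permutations xs) isEmpty ≈ 1ₛ (length xs)
  ∑-isEmpty []       = +-identityʳ 1#
  ∑-isEmpty (x ∷ xs) = begin
    -- Zero is written as `0# * 0#` so that a zero factor can be pulled out of the sum.
    ∑ (permutations (x ∷ xs)) isEmpty          ≈⟨ ∑-permutations-∷-cong x xs (λ _ _ → sym (zeroʳ 0#)) ⟩
    ∑ (permutations (x ∷ xs)) (λ _ → 0# * 0#)  ≈⟨ ∑-*ˡ (permutations (x ∷ xs)) 0# (λ _ → 0#) ⟩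
    0# * ∑ (permutations (x ∷ xs)) (λ _ → 0#)  ≈⟨ zeroˡ _ ⟩
    0#                                         ∎

  module _ (xs : List ℕ) (α : Series)
           (total≈α : ∀ {ys} → ys ⊆ xs → total ys ≈ α (length ys)) where

    private
      u e : List ℕ → Carrier
      u = nonemptyWeight
      e = isEmpty

      ∑∑ : (List ℕ → List ℕ → Carrier) → Carrier
      ∑∑ h = ∑ (permutations xs) (λ ρ → ∑-factors ρ h)

      ∑∑-+ : ∀ h k → ∑∑ (λ σ τ → h σ τ + k σ τ) ≈ ∑∑ h + ∑∑ k
      ∑∑-+ h k = trans (∑-cong (permutations xs) (λ ρ → ∑-factors-+ ρ h k))
        (∑-+ (permutations xs) _ _)

      ∑∑-*ˡ : ∀ a h → ∑∑ (λ σ τ → a * h σ τ) ≈ a * ∑∑ h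
      ∑∑-*ˡ a h = trans (∑-cong (permutations xs) (λ ρ → ∑-factors-*ˡ ρ a h))
        (∑-*ˡ (permutations xs) a _)

      ∑∑-⊛ : ∀ {f g φ γ} → (∀ {ys} → ys ⊆ xs → ∑ (permutations ys) f ≈ φ (length ys)) →
             (∀ {ys} → ys ⊆ xs → ∑ (permutations ys) g ≈ γ (length ys)) →
             ∑∑ (λ σ τ → f σ * g τ) ≈ (φ ⊛ γ) (length xs)
      ∑∑-⊛ {f} {g} {φ} {γ} f≈φ g≈γ = begin
        ∑∑ (λ σ τ → f σ * g τ)
          ≈⟨ ∑-permutations-factors xs f g ⟩
        ∑-bipartitions xs (λ ys zs → ∑ (permutations ys) f * ∑ (permutations zs) g)
          ≈⟨ ∑-bipartitions-cong xs (λ ys⊆ zs⊆ → *-cong (f≈φ ys⊆) (g≈γ zs⊆)) ⟩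
        ∑-bipartitions xs (λ ys zs → φ (length ys) * γ (length zs))
          ≈⟨ ∑-bipartitions-⊛ xs φ γ ⟩
        (φ ⊛ γ) (length xs) ∎

    -- Inserting `x` into `ρ` amounts to cutting `ρ`, and the sum over all cuts becomes a
    -- convolution. The totals of `isEmpty` are the unit for `⊛`, so the two mixed terms each give
    -- `α`, whence the coefficient 2t. The series `α` is arbitrary here because only sublists of
    -- `xs` need to be known.
    total-∷ : ∀ {x} → All (ℕ._< x) xs →
      total (x ∷ xs) ≈ (1ₛ +ₛ (((2 ×# t) ·ₛ α) +ₛ (s ·ₛ (α ⊛ α)))) (length xs)
    total-∷ {x} xs<x = begin
      total (x ∷ xs)
        ≈⟨ ∑-permutations-∷-cong x xs (λ _ _ → refl) ⟩
      ∑ (permutations (x ∷ xs)) weight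
        ≈⟨ ∑-permutations x xs weight ⟩
      ∑ (permutations xs) (λ ρ → ∑ (insertions x ρ) weight)
        ≈⟨ ∑-cong-∈ (permutations xs) (λ {ρ} ρ∈ → trans (∑-insertions x ρ weight)
             (∑-factors-cong ρ λ σ τ eq →
               let σ<x , τ<x = All.++⁻ σ (≡.subst (All (ℕ._< x)) (≡.sym eq)
                     (All-resp-↭ (↭-sym (∈-permutations⁻ xs ρ∈)) xs<x))
               in weight-max σ τ σ<x τ<x)) ⟩
      ∑∑ (λ σ τ → (s * (u σ * u τ) + t * (e σ * u τ + u σ * e τ)) + e σ * e τ)
        ≈⟨ trans (∑∑-+ _ _) (+-congʳ (trans (∑∑-+ _ _)
             (+-cong (∑∑-*ˡ s _) (trans (∑∑-*ˡ t _) (*-congˡ (∑∑-+ _ _)))))) ⟩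
      (s * ∑∑ (λ σ τ → u σ * u τ) + t * (∑∑ (λ σ τ → e σ * u τ) + ∑∑ (λ σ τ → u σ * e τ)))
        + ∑∑ (λ σ τ → e σ * e τ)
        ≈⟨ +-cong (+-cong (*-congˡ (∑∑-⊛ total≈α total≈α)) (*-congˡ (+-cong
             (trans (∑∑-⊛ ε total≈α) (⊛-identityˡ α n)) (trans (∑∑-⊛ total≈α ε) (⊛-identityʳ α n)))))
             (trans (∑∑-⊛ ε ε) (⊛-identityˡ 1ₛ n)) ⟩
      (s * (α ⊛ α) n + t * (α n + α n)) + 1ₛ n
        -- The expression `t + (t + 0)` is what `2 ×# t` unfolds to.
        ≈⟨ solve 5 (λ s t a b o → (s :* b :+ t :* (a :+ a)) :+ o
                               := o :+ ((t :+ (t :+ con 0)) :* a :+ s :* b)) refl s t _ _ _ ⟩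
      1ₛ n + ((2 ×# t) * α n + s * (α ⊛ α) n) ∎
      where
      n : ℕ
      n = length xs
      ε : ∀ {ys} → ys ⊆ xs → ∑ (permutations ys) e ≈ 1ₛ (length ys)
      ε {ys} _ = ∑-isEmpty ys

  -- `permutations` inserts the head of a list last. In a decreasing list the head is the maximum,
  -- as `total-∷` requires, and the sublists produced by bipartitions are decreasing again.
  Decreasing : List ℕ → Set
  Decreasing = AllPairs ℕ._>_

  Decreasing-resp-⊆ : ∀ {xs ys} → ys ⊆ xs → Decreasing xs → Decreasing ys
  Decreasing-resp-⊆ []                 []           = []
  Decreasing-resp-⊆ (_ Sublist.∷ʳ p)   (_ ∷ dec)    = Decreasing-resp-⊆ p dec
  Decreasing-resp-⊆ (≡.refl ∷ p)       (x> ∷ dec)   = All-resp-⊆ p x> ∷ Decreasing-resp-⊆ p dec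

  applyDownFrom-decreasing : ∀ n → Decreasing (applyDownFrom suc n)
  applyDownFrom-decreasing n = AllPairs.applyDownFrom⁺₁ suc n (λ j<i _ → s≤s j<i)

  α : Series
  α n = total (applyDownFrom suc n)

  α₀≈0 : α 0 ≈ 0#
  α₀≈0 = +-identityʳ 0#

  private
    rhs : Series
    rhs = 1ₛ +ₛ (((2 ×# t) ·ₛ α) +ₛ (s ·ₛ (α ⊛ α)))

  -- By the recurrence total-∷, the total of a decreasing word depends only on its length.
  mutual
    total-decreasing : ∀ m xs → length xs ≤ m → Decreasing xs → total xs ≈ α (length xs)
    total-decreasing m       []       _            _           = refl
    total-decreasing (suc m) (x ∷ xs) (s≤s |xs|≤m) dec = begin
      total (x ∷ xs)     ≈⟨ total-∷-decreasing m x xs |xs|≤m dec ⟩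
      rhs n              ≈⟨ reflexive (≡.cong rhs |ns|≡n) ⟨
      rhs (length ns)    ≈⟨ total-∷-decreasing m (suc n) ns (≡.subst (_≤ m) (≡.sym |ns|≡n) |xs|≤m)
                              (applyDownFrom-decreasing (suc n)) ⟨
      α (suc n)          ∎
      where
      n : ℕ
      n = length xs
      ns : List ℕ
      ns = applyDownFrom suc n
      |ns|≡n : length ns ≡ n
      |ns|≡n = length-applyDownFrom suc n

    total-∷-decreasing : ∀ m x xs → length xs ≤ m → Decreasing (x ∷ xs) →
                         total (x ∷ xs) ≈ rhs (length xs)
    total-∷-decreasing m x xs |xs|≤m (xs<x ∷ dec) = total-∷ xs α
      (λ {ys} ys⊆xs → total-decreasing m ys (ℕ.≤-trans (length-mono-≤ ys⊆xs) |xs|≤m)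
        (Decreasing-resp-⊆ ys⊆xs dec))
      xs<x

  α′ : α ∘ suc ≋ 1ₛ +ₛ (((2 ×# t) ·ₛ α) +ₛ (s ·ₛ (α ⊛ α)))
  α′ n = trans
    (total-∷-decreasing _ (suc n) (applyDownFrom suc n) ℕ.≤-refl (applyDownFrom-decreasing (suc n)))
    (reflexive (≡.cong rhs (length-applyDownFrom suc n)))

  α-suc : ∀ n → α (suc n) ≈ ∑ (permutations (applyDownFrom suc (suc n))) weight
  α-suc n = ∑-permutations-∷-cong (suc n) (applyDownFrom suc n) (λ _ _ → refl)

-- The Chebyshev recurrence as a differential equation

module Chebyshev {c ℓ} (R : CommutativeRing c ℓ) (s τ : CommutativeRing.Carrier R) where

  open CommutativeRing R
  open PowerSeries R
  open BinomialConvolution R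
  open RingProperties ring using (//-rightDividesˡ)
  open Solver commutativeSemiring using (solve; con; _:=_; _:+_; _:*_)

  module _ (U v : Series) (U₀≈1 : U 0 ≈ 1#) (U₁≈τ : U 1 ≈ τ)
           (U-step : ∀ n → U (2 ℕ.+ n) ≈ τ * U (suc n) - s * U n)
           (v₀≈0 : v 0 ≈ 0#) (v₁≈0 : v 1 ≈ 0#) (v≈U : ∀ n → v (2 ℕ.+ n) ≈ U n) where

    -- The two leading zeros of `v` act as U₋₁ = U₋₂ = 0. They extend the recurrence down to index
    -- 0, where the term 1 supplies the value U₀ = 1.
    v″ : ((v ∘ suc) ∘ suc) +ₛ (s ·ₛ v) ≋ 1ₛ +ₛ (τ ·ₛ (v ∘ suc))
    v″ zero          = +-cong (trans (v≈U 0) U₀≈1) (trans (*-congˡ v₀≈0)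
      (trans (solve 2 (λ s τ → s :* con 0 := τ :* con 0) refl s τ) (*-congˡ (sym v₁≈0))))
    v″ (suc zero)    = trans (+-cong (trans (v≈U 1) U₁≈τ) (*-congˡ v₁≈0))
      (trans (solve 2 (λ s τ → τ :+ s :* con 0 := con 0 :+ τ :* con 1) refl s τ)
        (+-congˡ (*-congˡ (sym (trans (v≈U 0) U₀≈1)))))
    v″ (suc (suc n)) = trans (+-cong (trans (v≈U (2 ℕ.+ n)) (U-step n)) (*-congˡ (v≈U n)))
      (trans (//-rightDividesˡ (s * U n) (τ * U (suc n)))
        (trans (*-congˡ (sym (v≈U (suc n)))) (sym (+-identityˡ _))))

-- Inverses of factorials among the constants

private
  module ℚₛₜ = CommutativeRing ℚ[s,t]
  open Mult ℚₛₜ.semiring using (×-assoc-*) renaming (_×_ to _×#_)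
  open Mult (CommutativeRing.semiring ℚ.+-*-commutativeRing) using () renaming (_×_ to _×ℚ_)

-- Sums of normalised fractions involve a gcd. Over unnormalised fractions the induction step is a
-- polynomial identity in integers.
×ℚ-1/ : ∀ k d → k ×ℚ ((+ 1) ℚ./ suc d) ≡ (+ k) ℚ./ suc d
×ℚ-1/ zero    d = ≡.sym (ℚ.0/n≡0 (suc d))
×ℚ-1/ (suc k) d = ≡.trans (≡.cong (ℚ._+_ ((+ 1) ℚ./ suc d)) (×ℚ-1/ k d)) (ℚ.toℚᵘ-injective (begin
  ℚ.toℚᵘ (ℚ.fromℚᵘ (mkℚᵘ (+ 1) d) ℚ.+ ℚ.fromℚᵘ (mkℚᵘ (+ k) d))
    ≈⟨ ℚ.toℚᵘ-homo-+ (ℚ.fromℚᵘ (mkℚᵘ (+ 1) d)) (ℚ.fromℚᵘ (mkℚᵘ (+ k) d)) ⟩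
  ℚ.toℚᵘ (ℚ.fromℚᵘ (mkℚᵘ (+ 1) d)) ℚᵘ.+ ℚ.toℚᵘ (ℚ.fromℚᵘ (mkℚᵘ (+ k) d))
    ≈⟨ ℚᵘ.+-cong (ℚ.toℚᵘ-fromℚᵘ (mkℚᵘ (+ 1) d)) (ℚ.toℚᵘ-fromℚᵘ (mkℚᵘ (+ k) d)) ⟩
  mkℚᵘ (+ 1) d ℚᵘ.+ mkℚᵘ (+ k) d
    ≈⟨ *≡* (solve 2 (λ k d → (con (+ 1) :* d :+ k :* d) :* d := (con (+ 1) :+ k) :* (d :* d))
         ≡.refl (+ k) (+ suc d)) ⟩
  mkℚᵘ (+ suc k) d
    ≈⟨ ℚ.toℚᵘ-fromℚᵘ (mkℚᵘ (+ suc k) d) ⟨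
  ℚ.toℚᵘ (ℚ.fromℚᵘ (mkℚᵘ (+ suc k) d)) ∎))
  where
  open SetoidReasoning ℚᵘ.≃-setoid
  open ℤSolver.+-*-Solver using (solve; con; _:=_; _:+_; _:*_)

×ℚ-inverse : ∀ d .{{_ : ℕ.NonZero d}} → d ×ℚ ((+ 1) ℚ./ d) ≡ ℚ.1ℚ
×ℚ-inverse (suc d) = ≡.trans (×ℚ-1/ (suc d) d)
  (ℚ.fromℚᵘ-cong {mkℚᵘ (+ suc d) d} {ℚᵘ.1ℚᵘ} (*≡* (ℤ.*-comm (+ suc d) (+ 1))))

-- The left side is a nested list holding one zero coefficient and the right side is the empty list,
-- so they agree only coefficientwise.
const-0 : const ℚ.0ℚ ℚₛₜ.≈ ℚₛₜ.0#
const-0 = Polyₜ.mk≈ λ where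
  zero    → Polyₛ.mk≈ λ { zero → ≡.refl ; (suc _) → ≡.refl }
  (suc _) → Polyₛ.mk≈ λ _ → ≡.refl

const-× : ∀ k q → k ×# const q ℚₛₜ.≈ const (k ×ℚ q)
const-× zero    q = ℚₛₜ.sym const-0
-- A sum of two constants reduces by computation to the constant of the sum.
const-× (suc k) q = ℚₛₜ.+-congˡ {const q} (const-× k q)

!-inverse : ∀ n → (n !) ×# const (1/ n !) ℚₛₜ.≈ ℚₛₜ.1#
!-inverse n = ℚₛₜ.trans (const-× (n !) (1/ n !))
  (ℚₛₜ.reflexive (≡.cong const (×ℚ-inverse (n !) {{n ℕ.!≢0}})))

-- Clearing factorials in P and V, and the conclusion

open import Defs

private
  open PeakRecurrence ℚ[s,t] s t using (α; α₀≈0; α′; α-suc)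

  chebyshev : Series
  chebyshev zero          = ℚₛₜ.0#
  chebyshev (suc zero)    = ℚₛₜ.0#
  chebyshev (suc (suc n)) = U n

  !-clear : ∀ n a → (n !) ×# (const (1/ n !) ℚₛₜ.* a) ℚₛₜ.≈ a
  !-clear n a = begin
    (n !) ×# (const (1/ n !) ℚₛₜ.* a)    ≈⟨ ×-assoc-* (n !) (const (1/ n !)) a ⟨
    ((n !) ×# const (1/ n !)) ℚₛₜ.* a    ≈⟨ ℚₛₜ.*-congʳ {a} (!-inverse n) ⟩
    ℚₛₜ.1# ℚₛₜ.* a                       ≈⟨ ℚₛₜ.*-identityˡ a ⟩
    a                                    ∎
    where open SetoidReasoning ℚₛₜ.setoid

  egf⁻¹-P : BinomialConvolution.egf⁻¹ ℚ[s,t] P ≋ α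
  egf⁻¹-P zero    = ℚₛₜ.sym α₀≈0
  egf⁻¹-P (suc n) = ℚₛₜ.trans (!-clear (suc n) (permutationPolynomial (suc n))) (ℚₛₜ.sym (α-suc n))

  egf⁻¹-V : BinomialConvolution.egf⁻¹ ℚ[s,t] V ≋ chebyshev
  egf⁻¹-V zero          = ℚₛₜ.refl
  egf⁻¹-V (suc zero)    = ℚₛₜ.refl
  egf⁻¹-V (suc (suc n)) = !-clear (suc (suc n)) (U n)

theorem3 : P ≋ (∂ V) /ₛ (1ₛ -ₛ s ·ₛ V)
theorem3 = Riccati.riccati ℚ[s,t] (λ n → const (1/ n !)) !-inverse s (2 ×# t)
  egf⁻¹-P egf⁻¹-V α₀≈0 α′ ℚₛₜ.refl ℚₛₜ.refl
  (Chebyshev.v″ ℚ[s,t] s (2 ×# t) U chebyshev ℚₛₜ.refl ℚₛₜ.refl (λ _ → ℚₛₜ.refl)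
    ℚₛₜ.refl ℚₛₜ.refl (λ _ → ℚₛₜ.refl))
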